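{- Let $(W,S)$ be a Coxeter group with Coxeter matrix $(m_{s,s'})_{(s,s')\in S\times S}$, and let $w\in W$. Let $C$ be a directed cycle in the edge-colored directed graph $\mathcal{R}(w)$. Let $c=[(s,t)]\in\mathfrak{M}/\sim$ be an equivalence class, and let $c^{\mathrm{op}}=[(t,s)]\in\mathfrak{M}/\sim$. Then: (a) The number of arcs colored $c$ appearing in $C$ equals the number of arcs colored $c^{\mathrm{op}}$ appearing in $C$. (b) The number of arcs whose color belongs to $\{c,c^{\mathrm{op}}\}$ appearing in $C$ is even.
   Context: A Coxeter group is a pair $(W,S)$ where $W$ is a group and $S$ a finite subset of $W$ such that there is a matrix $(m_{s,s'})\in\{1,2,3,\ldots,\infty\}^{S\times S}$ with $m_{s,s}=1$, $m_{s,t}=m_{t,s}\geq 2$ for distinct $s,t$, and $W$ is presented by generators $S$ and relations $(st)^{m_{s,t}}=1$ for all $(s,t)$ with $m_{s,t}\neq\infty$ (this is the Coxeter matrix; $m_{s,t}$ is the order of $st$). Let $\mathfrak{M}=\{(s,t)\in S\times S : s\neq t,\ m_{s,t}<\infty\}$. Define the equivalence relation $\sim$ on $\mathfrak{M}$ by $(s,t)\sim(s',t')$ iff there is $q\in W$ with $qsq^{ -1}=s'$ and $qtq^{ -1}=t'$; $[P]$ denotes the class of $P\in\mathfrak{M}$. A reduced expression for $w\in W$ is a tuple $(a_1,\ldots,a_k)$ of elements of $S$ with $w=a_1\cdots a_k$ and $k$ minimal. A factor of a word $(a_1,\ldots,a_k)$ is a contiguous subword $(a_{i+1},\ldots,a_{i+m})$.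 For $(s,t)\in\mathfrak{M}$ and reduced expressions $\vec a,\vec b$ of $w$, $\vec b$ is obtained from $\vec a$ by an $(s,t)$-braid move if $\vec b$ arises from $\vec a$ by replacing a factor of the form $(s,t,s,t,\ldots)$ ($m_{s,t}$ entries) by $(t,s,t,s,\ldots)$ ($m_{s,t}$ entries). The graph $\mathcal{R}(w)$ has as vertices the reduced expressions of $w$, and for every $(s,t)\in\mathfrak{M}$ and reduced expressions $\vec a,\vec b$ of $w$ such that $\vec b$ is obtained from $\vec a$ by an $(s,t)$-braid move, an arc from $\vec a$ to $\vec b$ colored $[(s,t)]$. -}

module Defs where

open import Level using (Level; 0ℓ; _⊔_) renaming (suc to lsuc)
open import Algebra.Bundles using (Group)
open import Algebra.Morphism.Structures using (module GroupMorphisms)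
import Algebra.Properties.Group as GroupProperties
open import Data.Fin using (Fin)
open import Data.List using (List; []; _∷_; _++_; foldr; length; filter)
open import Data.List.Relation.Unary.Unique.Propositional using (Unique)
open import Data.Nat using (ℕ; zero; suc; _≤_)
open import Data.Product using (∃; ∃-syntax; _×_; _,_; proj₁)
open import Function.Definitions using (Injective)
open import Relation.Binary using (Rel; Setoid; IsEquivalence)
open import Relation.Binary.Construct.Closure.Transitive using (TransClosure; [_]; _∷_)
import Relation.Binary.Construct.Add.Supremum.NonStrict as AddSupremum
open import Relation.Binary.PropositionalEquality using (_≡_; _≢_; refl; cong; sym; trans)
open import Relation.Nullary using (¬_; yes; no; contradiction)
open import Relation.Nullary.Construct.Add.Supremum using (_⁺; ⊤⁺; [_])
import Relation.Unary as U

infixl 7 _·_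
infix  8 _⁻

data Term (X : Set) : Set where
  var : X → Term X
  _·_ : Term X → Term X → Term X
  𝟏   : Term X
  _⁻  : Term X → Term X

_^ᵗ_ : {X : Set} → Term X → ℕ → Term X
t ^ᵗ zero  = 𝟏
t ^ᵗ suc k = t · (t ^ᵗ k)

-- The least congruence on terms containing the group axioms and r = 1 for
-- every relator r.
module Presentation {X : Set} (Relator : U.Pred (Term X) 0ℓ) where

  infix 4 _≋_

  data _≋_ : Rel (Term X) 0ℓ where
    ≋-refl    : ∀ {x} → x ≋ x
    ≋-sym     : ∀ {x y} → x ≋ y → y ≋ x
    ≋-trans   : ∀ {x y z} → x ≋ y → y ≋ z → x ≋ z
    ·-cong    : ∀ {x x′ y y′} → x ≋ x′ → y ≋ y′ → x · y ≋ x′ · y′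
    ⁻-cong    : ∀ {x x′} → x ≋ x′ → x ⁻ ≋ x′ ⁻
    assoc     : ∀ x y z → (x · y) · z ≋ x · (y · z)
    identityˡ : ∀ x → 𝟏 · x ≋ x
    identityʳ : ∀ x → x · 𝟏 ≋ x
    inverseˡ  : ∀ x → x ⁻ · x ≋ 𝟏
    inverseʳ  : ∀ x → x · x ⁻ ≋ 𝟏
    relator   : ∀ {r} → Relator r → r ≋ 𝟏

  presentedGroup : Group 0ℓ 0ℓ
  presentedGroup = record
    { Carrier = Term X ; _≈_ = _≋_ ; _∙_ = _·_ ; ε = 𝟏 ; _⁻¹ = _⁻
    ; isGroup = record
      { isMonoid = record
        { isSemigroup = record
          { isMagma = record
            { isEquivalence = record { refl = ≋-refl ; sym = ≋-sym ; trans = ≋-trans }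
            ; ∙-cong = ·-cong }
          ; assoc = assoc }
        ; identity = identityˡ , identityʳ }
      ; inverse = inverseˡ , inverseʳ
      ; ⁻¹-cong = ⁻-cong } }

module _ {g ℓ : Level} (G : Group g ℓ) where

  open Group G

  eval : {X : Set} → (X → Carrier) → Term X → Carrier
  eval f (var x) = f x
  eval f (x · y) = eval f x ∙ eval f y
  eval f 𝟏       = ε
  eval f (x ⁻)   = (eval f x) ⁻¹

  -- G is presented by generators f and the given relators: the canonical map
  -- from the presented group to G is an isomorphism.
  IsPresentedBy : {X : Set} → (X → Carrier) → U.Pred (Term X) 0ℓ → Set (g ⊔ ℓ)
  IsPresentedBy f Relator = IsGroupIsomorphism (eval f)
    where
    open Presentation Relator
    open GroupMorphisms (Group.rawGroup presentedGroup) rawGroup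

open AddSupremum _≤_ using (_≤⁺_)

-- ℕ ⁺ is ℕ with a top element ⊤⁺, which plays the role of ∞.
record CoxeterMatrix (X : Set) : Set where
  field
    m         : X → X → ℕ ⁺
    diagonal  : ∀ s → m s s ≡ [ 1 ]
    symmetric : ∀ s t → m s t ≡ m t s
    atLeast2  : ∀ {s t} → s ≢ t → [ 2 ] ≤⁺ m s t

data CoxeterRelator {X : Set} (M : CoxeterMatrix X) : U.Pred (Term X) 0ℓ where
  relator : ∀ {s t k} → CoxeterMatrix.m M s t ≡ [ k ] →
            CoxeterRelator M ((var s · var t) ^ᵗ k)

-- The finite subset S of W is the image of the injective family gen.
record CoxeterGroup (g ℓ : Level) : Set (lsuc (g ⊔ ℓ)) where
  field
    W             : Group g ℓ
    rank          : ℕ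
    gen           : Fin rank → Group.Carrier W
    gen-injective : Injective _≡_ (Group._≈_ W) gen
    matrix        : CoxeterMatrix (Fin rank)
    presented     : IsPresentedBy W gen (CoxeterRelator matrix)

  S : Set
  S = Fin rank

  open Group W public
  open CoxeterMatrix matrix public using (m)

-- Count P xs k: exactly k of the entries of xs satisfy P. This is a relation
-- rather than a function because P need not be decidable; the lemmas below
-- show that k is unique, that it cannot fail to exist, and that for decidable P
-- it is the length of the filtered list.
data Count {a p} {A : Set a} (P : U.Pred A p) : List A → ℕ → Set (a ⊔ p) where
  []   : Count P [] 0
  hit  : ∀ {x xs k} → P x → Count P xs k → Count P (x ∷ xs) (suc k)
  miss : ∀ {x xs k} → ¬ P x → Count P xs k → Count P (x ∷ xs) k

module _ {a p} {A : Set a} {P : U.Pred A p} where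

  count-unique : ∀ {xs k l} → Count P xs k → Count P xs l → k ≡ l
  count-unique []         []         = refl
  count-unique (hit _ c)  (hit _ d)  = cong suc (count-unique c d)
  count-unique (hit p _)  (miss ¬p _) = contradiction p ¬p
  count-unique (miss ¬p _) (hit p _) = contradiction p ¬p
  count-unique (miss _ c) (miss _ d) = count-unique c d

  count-¬¬exists : ∀ xs → ¬ ¬ (∃[ k ] Count P xs k)
  count-¬¬exists []       ¬c = ¬c (0 , [])
  count-¬¬exists (x ∷ xs) ¬c = count-¬¬exists xs λ (k , c) →
    ¬c (k , miss (λ p → ¬c (suc k , hit p c)) c)

  count-filter : (P? : U.Decidable P) → ∀ xs → Count P xs (length (filter P? xs))
  count-filter P? []       = []
  count-filter P? (x ∷ xs) with P? x
  ... | yes p = hit p (count-filter P? xs)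
  ... | no ¬p = miss ¬p (count-filter P? xs)

alternating : {X : Set} → ℕ → X → X → List X
alternating zero    s t = []
alternating (suc k) s t = s ∷ alternating k t s

module Coxeter {g ℓ : Level} (X : CoxeterGroup g ℓ) where

  open CoxeterGroup X using (W; S; gen; matrix; m; Carrier; _≈_; _∙_; ε; _⁻¹; setoid)
  private module W = Group W
  open GroupProperties W using (⁻¹-anti-homo-∙)

  record 𝔐 : Set where
    field
      fst snd : S
      fst≢snd : fst ≢ snd
      order   : ℕ
      finite  : m fst snd ≡ [ order ]

  _ᵒᵖ : 𝔐 → 𝔐
  P ᵒᵖ = record
    { fst     = snd
    ; snd     = fst
    ; fst≢snd = λ eq → fst≢snd (sym eq)
    ; order   = order
    ; finite  = trans (CoxeterMatrix.symmetric matrix snd fst) finite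
    } where open 𝔐 P

  conj : Carrier → Carrier → Carrier
  conj q x = q ∙ x ∙ q ⁻¹

  infix 4 _∼_

  _∼_ : Rel 𝔐 (g ⊔ ℓ)
  P ∼ Q = ∃[ q ] (conj q (gen (𝔐.fst P)) ≈ gen (𝔐.fst Q))
               × (conj q (gen (𝔐.snd P)) ≈ gen (𝔐.snd Q))

  private
    open import Relation.Binary.Reasoning.Setoid setoid

    conj-ε : ∀ x → conj ε x ≈ x
    conj-ε x = begin
      ε ∙ x ∙ ε ⁻¹ ≈⟨ W.∙-cong (W.identityˡ x) (GroupProperties.ε⁻¹≈ε W) ⟩
      x ∙ ε        ≈⟨ W.identityʳ x ⟩
      x            ∎

    conj-∙ : ∀ p q x → conj (p ∙ q) x ≈ conj p (conj q x)
    conj-∙ p q x = begin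
      p ∙ q ∙ x ∙ (p ∙ q) ⁻¹       ≈⟨ W.∙-congˡ (⁻¹-anti-homo-∙ p q) ⟩
      p ∙ q ∙ x ∙ (q ⁻¹ ∙ p ⁻¹)    ≈⟨ W.assoc _ _ _ ⟨
      p ∙ q ∙ x ∙ q ⁻¹ ∙ p ⁻¹      ≈⟨ W.∙-congʳ (W.∙-congʳ (W.assoc _ _ _)) ⟩
      p ∙ (q ∙ x) ∙ q ⁻¹ ∙ p ⁻¹    ≈⟨ W.∙-congʳ (W.assoc _ _ _) ⟩
      p ∙ (q ∙ x ∙ q ⁻¹) ∙ p ⁻¹    ∎

    conj-cong : ∀ {p q x y} → p ≈ q → x ≈ y → conj p x ≈ conj q y
    conj-cong p≈q x≈y = W.∙-cong (W.∙-cong p≈q x≈y) (W.⁻¹-cong p≈q)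

    conj-sym : ∀ q {x y} → conj q x ≈ y → conj (q ⁻¹) y ≈ x
    conj-sym q {x} {y} eq = begin
      conj (q ⁻¹) y          ≈⟨ conj-cong W.refl eq ⟨
      conj (q ⁻¹) (conj q x) ≈⟨ conj-∙ (q ⁻¹) q x ⟨
      conj (q ⁻¹ ∙ q) x      ≈⟨ conj-cong (W.inverseˡ q) W.refl ⟩
      conj ε x               ≈⟨ conj-ε x ⟩
      x                      ∎

    conj-trans : ∀ p q {x y z} → conj q x ≈ y → conj p y ≈ z → conj (p ∙ q) x ≈ z
    conj-trans p q {x} {y} {z} e f = begin
      conj (p ∙ q) x      ≈⟨ conj-∙ p q x ⟩
      conj p (conj q x)   ≈⟨ conj-cong W.refl e ⟩
      conj p y            ≈⟨ f ⟩
      z                   ∎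

  ∼-isEquivalence : IsEquivalence _∼_
  ∼-isEquivalence = record
    { refl  = ε , conj-ε _ , conj-ε _
    ; sym   = λ (q , e , f) → q ⁻¹ , conj-sym q e , conj-sym q f
    ; trans = λ (q , e , f) (p , e′ , f′) →
                p ∙ q , conj-trans p q e e′ , conj-trans p q f f′
    }

  -- The quotient 𝔐/∼: a colour is given by a representative, and two colours
  -- are equal when their representatives are related by ∼.
  𝔐/∼ : Setoid 0ℓ (g ⊔ ℓ)
  𝔐/∼ = record { isEquivalence = ∼-isEquivalence }

  Colour : Set
  Colour = Setoid.Carrier 𝔐/∼

  ᵒᵖ-cong : ∀ {P Q} → P ∼ Q → P ᵒᵖ ∼ Q ᵒᵖ
  ᵒᵖ-cong (q , e , f) = q , f , e

  product : List S → Carrier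
  product = foldr (λ s x → gen s ∙ x) ε

  record IsReducedExpression (w : Carrier) (a : List S) : Set ℓ where
    field
      expresses : product a ≈ w
      minimal   : ∀ b → product b ≈ w → length a ≤ length b

  BraidMove : 𝔐 → Rel (List S) 0ℓ
  BraidMove P a b = ∃[ u ] ∃[ v ]
    (a ≡ u ++ alternating order fst snd ++ v) ×
    (b ≡ u ++ alternating order snd fst ++ v)
    where open 𝔐 P

  Vertex : Carrier → Set ℓ
  Vertex w = ∃ (IsReducedExpression w)

  record Arc {w : Carrier} (a b : Vertex w) : Set where
    field
      pair : 𝔐
      move : BraidMove pair (proj₁ a) (proj₁ b)

    colour : Colour
    colour = pair

  -- TransClosure rather than Star: a cycle has at least one arc.
  Walk : {w : Carrier} → Rel (Vertex w) ℓ
  Walk = TransClosure Arc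

  -- The underlying words of all vertices of a walk except its endpoint.
  words : ∀ {w} {a b : Vertex w} → Walk a b → List (List S)
  words {a = a} [ _ ]   = proj₁ a ∷ []
  words {a = a} (_ ∷ p) = proj₁ a ∷ words p

  colours : ∀ {w} {a b : Vertex w} → Walk a b → List Colour
  colours [ e ]   = Arc.colour e ∷ []
  colours (e ∷ p) = Arc.colour e ∷ colours p

  record DirectedCycle (w : Carrier) : Set ℓ where
    field
      base     : Vertex w
      walk     : Walk base base
      distinct : Unique (words walk)

  -- The number of arcs of the cycle whose colour satisfies P is k. The vertices
  -- of a cycle are distinct, so each of its arcs is counted once.
  NumberOfArcs : ∀ {w p} → DirectedCycle w → U.Pred Colour p → ℕ → Set p
  NumberOfArcs C P = Count P (colours (DirectedCycle.walk C))

{-# OPTIONS --safe #-}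

-- The inversions of a reduced word for w are pairwise distinct, and up to parity
-- of multiplicities they depend only on w. An (s,t)-braid move after a prefix of
-- product q reverses the block of inversions Z = q (s, sts, …, t) q⁻¹.
--
-- Let e be an arc with block Z. Projecting the path of any reduced word of w to the
-- coset q⟨s,t⟩ shows that it meets the elements of Z in the order of Z or of its
-- reversal. A further arc changes this order only if its own block is Z or the
-- reversal of Z, and these two change it in opposite directions. Hence along a
-- closed walk as many arcs have block Z as have the reversed block, so the arcs can
-- be paired off. The ends of Z are the conjugates of s and t by q, so paired arcs
-- have opposite colours.
--
-- Equality in W is not assumed decidable, so case distinctions are made under a
-- double negation; equality and divisibility of numbers are stable under it.
module Submission where

open import Defs
open import Algebra.Morphism.Structures using (module GroupMorphisms)
import Algebra.Properties.Group as GroupProperties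
open import Data.Bool using (Bool; true; false; not)
open import Data.Empty using (⊥; ⊥-elim)
open import Data.List using (List; []; _∷_; _++_; map; length; reverse; applyUpTo; applyDownFrom)
import Data.List.Properties as List
open import Data.List.Relation.Binary.Permutation.Propositional using (_↭_)
import Data.List.Relation.Binary.Permutation.Propositional as ↭
import Data.List.Relation.Binary.Permutation.Propositional.Properties as ↭
import Data.List.Membership.Setoid.Properties as Membership
open import Data.List.Relation.Unary.Any using (here; there)
open import Data.List.Relation.Binary.Pointwise using (Pointwise; []; _∷_)
import Data.List.Relation.Binary.Equality.Setoid as SetoidEquality
open import Data.List.Relation.Unary.All using (All; []; _∷_)
import Data.List.Relation.Unary.All as All
import Data.List.Relation.Unary.All.Properties as All
open import Data.List.Relation.Unary.AllPairs using (AllPairs; []; _∷_)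
import Data.List.Relation.Unary.AllPairs as AllPairs
import Data.List.Relation.Unary.AllPairs.Properties as AllPairs
open import Data.Nat using (ℕ; zero; suc; _+_; _*_; _≤_; _<_; z≤n; s≤s; s≤s⁻¹; parity)
import Data.Nat.Properties as ℕ
open import Data.Nat.Divisibility using (_∣_; divides; _∣?_; ∣m∣n⇒∣m+n)
open import Data.Parity using (0ℙ; 1ℙ)
import Data.Parity as ℙ
import Data.Parity.Properties as ℙ
open import Data.Product using (_×_; _,_; proj₁; proj₂; ∃₂; ∃-syntax)
open import Data.Sum using (_⊎_; inj₁; inj₂)
import Data.Sum as Sum
open import Function using (_∘_; id)
open import Level using (Level)
open import Relation.Binary using (Rel; REL; Setoid; IsEquivalence; _Respects_; tri<; tri≈; tri>)
open import Relation.Binary.Construct.Add.Supremum.NonStrict _≤_ using ([≤]-injective)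
open import Relation.Binary.Construct.Closure.Transitive using ([_]; _∷_)
open import Relation.Binary.PropositionalEquality as ≡ using (_≡_; _≢_)
open import Relation.Nullary using (¬_; yes; no; contradiction)
open import Relation.Nullary.Construct.Add.Supremum using ([_])
open import Relation.Nullary.Decidable using (decidable-stable)
open import Relation.Unary using (Pred)

private
  variable
    a b p q r ℓ : Level
    A : Set a
    B : Set b

-- Counts and restrictions of lists.

module _ {P : Pred A p} where

  count-++⁻ : ∀ xs {ys n} → Count P (xs ++ ys) n →
              ∃₂ λ k l → Count P xs k × Count P ys l × n ≡ k + l
  count-++⁻ []       c          = 0 , _ , [] , c , ≡.refl
  count-++⁻ (x ∷ xs) (hit px c) =
    let k , l , c₁ , c₂ , eq = count-++⁻ xs c in suc k , l , hit px c₁ , c₂ , ≡.cong suc eq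
  count-++⁻ (x ∷ xs) (miss ¬px c) =
    let k , l , c₁ , c₂ , eq = count-++⁻ xs c in k , l , miss ¬px c₁ , c₂ , eq

  count-++⁺ : ∀ {xs ys k l} → Count P xs k → Count P ys l → Count P (xs ++ ys) (k + l)
  count-++⁺ []           d = d
  count-++⁺ (hit px c)   d = hit px (count-++⁺ c d)
  count-++⁺ (miss ¬px c) d = miss ¬px (count-++⁺ c d)

  count-map⁻ : ∀ {f : B → A} xs {k} → Count P (map f xs) k → Count (P ∘ f) xs k
  count-map⁻ []       []           = []
  count-map⁻ (x ∷ xs) (hit px c)   = hit px (count-map⁻ xs c)
  count-map⁻ (x ∷ xs) (miss ¬px c) = miss ¬px (count-map⁻ xs c)

  count-none : ∀ {xs} → All (¬_ ∘ P) xs → Count P xs 0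
  count-none []         = []
  count-none (¬px ∷ ps) = miss ¬px (count-none ps)

count-transfer : ∀ {P : Pred A p} {Q : Pred B q} {R : REL A B r} →
                 (∀ {x y} → R x y → P x → Q y) → (∀ {x y} → R x y → Q y → P x) →
                 ∀ {xs ys k} → Pointwise R xs ys → Count P xs k → Count Q ys k
count-transfer f g []       []           = []
count-transfer f g (r ∷ rs) (hit px c)   = hit (f r px) (count-transfer f g rs c)
count-transfer f g (r ∷ rs) (miss ¬px c) = miss (¬px ∘ g r) (count-transfer f g rs c)

all-reverse : ∀ {P : Pred A p} {xs} → All P xs → All P (reverse xs)
all-reverse []                 = []
all-reverse {xs = x ∷ xs} (px ∷ ps) rewrite List.unfold-reverse x xs =
  All.++⁺ (all-reverse ps) (px ∷ [])

-- Like Count, a relation because P need not be decidable.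
data Restriction {A : Set a} (P : Pred A p) : List A → List A → Set (a Level.⊔ p) where
  []   : Restriction P [] []
  hit  : ∀ {x xs ys} → P x → Restriction P xs ys → Restriction P (x ∷ xs) (x ∷ ys)
  miss : ∀ {x xs ys} → ¬ P x → Restriction P xs ys → Restriction P (x ∷ xs) ys

module _ {P : Pred A p} where

  restriction-¬¬exists : ∀ xs → ¬ ¬ (∃[ ys ] Restriction P xs ys)
  restriction-¬¬exists []       ¬r = ¬r ([] , [])
  restriction-¬¬exists (x ∷ xs) ¬r = restriction-¬¬exists xs λ (ys , r) →
    ¬r (ys , miss (λ px → ¬r (x ∷ ys , hit px r)) r)

  restriction-unique : ∀ {xs ys zs} → Restriction P xs ys → Restriction P xs zs → ys ≡ zs
  restriction-unique []           []           = ≡.refl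
  restriction-unique (hit _ r)    (hit _ s)    = ≡.cong (_ ∷_) (restriction-unique r s)
  restriction-unique (hit px _)   (miss ¬px _) = contradiction px ¬px
  restriction-unique (miss ¬px _) (hit px _)   = contradiction px ¬px
  restriction-unique (miss _ r)   (miss _ s)   = restriction-unique r s

  restriction-++⁺ : ∀ {xs ys us vs} → Restriction P xs us → Restriction P ys vs →
                    Restriction P (xs ++ ys) (us ++ vs)
  restriction-++⁺ []           s = s
  restriction-++⁺ (hit px r)   s = hit px (restriction-++⁺ r s)
  restriction-++⁺ (miss ¬px r) s = miss ¬px (restriction-++⁺ r s)

  restriction-reverse : ∀ {xs ys} → Restriction P xs ys → Restriction P (reverse xs) (reverse ys)
  restriction-reverse [] = []
  restriction-reverse {x ∷ xs} {_ ∷ ys} (hit px r) =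
    ≡.subst₂ (Restriction P) (≡.sym (List.unfold-reverse x xs)) (≡.sym (List.unfold-reverse x ys))
      (restriction-++⁺ (restriction-reverse r) (hit px []))
  restriction-reverse {x ∷ xs} {ys} (miss ¬px r) =
    ≡.subst₂ (Restriction P) (≡.sym (List.unfold-reverse x xs)) (List.++-identityʳ (reverse ys))
      (restriction-++⁺ (restriction-reverse r) (miss ¬px []))

  restriction-map⁻ : ∀ {f : B → A} xs {ys} → Restriction P (map f xs) ys →
                     ∃[ zs ] ys ≡ map f zs × Restriction (P ∘ f) xs zs
  restriction-map⁻ []       []           = [] , ≡.refl , []
  restriction-map⁻ (x ∷ xs) (hit px r)   =
    let zs , eq , s = restriction-map⁻ xs r in x ∷ zs , ≡.cong (_ ∷_) eq , hit px s
  restriction-map⁻ (x ∷ xs) (miss ¬px r) =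
    let zs , eq , s = restriction-map⁻ xs r in zs , eq , miss ¬px s

  restriction-map⁺ : ∀ {f : B → A} {xs ys} → Restriction (P ∘ f) xs ys →
                     Restriction P (map f xs) (map f ys)
  restriction-map⁺ []           = []
  restriction-map⁺ (hit px r)   = hit px (restriction-map⁺ r)
  restriction-map⁺ (miss ¬px r) = miss ¬px (restriction-map⁺ r)

  restriction-⇔ : ∀ {Q : Pred A q} → (∀ {x} → P x → Q x) → (∀ {x} → Q x → P x) →
                  ∀ {xs ys} → Restriction P xs ys → Restriction Q xs ys
  restriction-⇔ f g []           = []
  restriction-⇔ f g (hit px r)   = hit (f px) (restriction-⇔ f g r)
  restriction-⇔ f g (miss ¬px r) = miss (¬px ∘ g) (restriction-⇔ f g r)

  restriction-satisfies : ∀ {xs ys} → Restriction P xs ys → All P ys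
  restriction-satisfies []         = []
  restriction-satisfies (hit px r) = px ∷ restriction-satisfies r
  restriction-satisfies (miss _ r) = restriction-satisfies r

  restriction-total : ∀ {xs ys} → All P xs → Restriction P xs ys → ys ≡ xs
  restriction-total []        []           = ≡.refl
  restriction-total (_ ∷ ps)  (hit _ r)    = ≡.cong (_ ∷_) (restriction-total ps r)
  restriction-total (px ∷ _)  (miss ¬px _) = contradiction px ¬px

  restriction-length : ∀ {xs ys} → Restriction P xs ys → length ys ≤ length xs
  restriction-length []         = z≤n
  restriction-length (hit _ r)  = s≤s (restriction-length r)
  restriction-length (miss _ r) = ℕ.m≤n⇒m≤1+n (restriction-length r)

  restriction-full : ∀ {xs ys} → Restriction P xs ys → length xs ≤ length ys → ys ≡ xs
  restriction-full []         _       = ≡.refl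
  restriction-full (hit _ r)  (s≤s h) = ≡.cong (_ ∷_) (restriction-full r h)
  restriction-full (miss _ r) h       =
    contradiction (ℕ.≤-trans h (restriction-length r)) ℕ.1+n≰n

  restriction-All : ∀ {Q : Pred A q} {xs ys} → Restriction P xs ys → All Q xs → All Q ys
  restriction-All []         []        = []
  restriction-All (hit _ r)  (qx ∷ qs) = qx ∷ restriction-All r qs
  restriction-All (miss _ r) (_ ∷ qs)  = restriction-All r qs

  restriction-AllPairs : ∀ {R : Rel A r} {xs ys} → Restriction P xs ys → AllPairs R xs → AllPairs R ys
  restriction-AllPairs []         []        = []
  restriction-AllPairs (hit _ r)  (qx ∷ qs) = restriction-All r qx ∷ restriction-AllPairs r qs
  restriction-AllPairs (miss _ r) (_ ∷ qs)  = restriction-AllPairs r qs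

-- Duplicate-free lists over a setoid and their reversals.

module SetoidLists (S : Setoid a ℓ) where

  open Setoid S renaming (Carrier to C)
  open SetoidEquality S public using (_≋_; ≋-setoid; ≋-refl; ≋-sym; ≋-trans; ≋-reflexive; ≋-length; Unique-resp-≋; All-resp-≋; ++⁺; ++⁺ˡ; ++-cancelˡ; ++-cancelʳ; reverse⁺)
  open import Data.List.Membership.Setoid S public using (_∈_)
  open import Data.List.Relation.Unary.Unique.Setoid S public using (Unique)

  module _ {P : Pred C p} (P-resp : P Respects _≈_) where

    restriction-≋ : ∀ {xs ys us} → xs ≋ ys → Restriction P xs us → ∃[ vs ] us ≋ vs × Restriction P ys vs
    restriction-≋ []         []           = [] , [] , []
    restriction-≋ (eq ∷ eqs) (hit px r)   =
      let vs , e , s = restriction-≋ eqs r in _ ∷ vs , eq ∷ e , hit (P-resp eq px) s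
    restriction-≋ (eq ∷ eqs) (miss ¬px r) =
      let vs , e , s = restriction-≋ eqs r in vs , e , miss (¬px ∘ P-resp (sym eq)) s

    restriction-∈ : ∀ {xs ys x} → P x → x ∈ xs → Restriction P xs ys → x ∈ ys
    restriction-∈ px (here eq)   (hit _ _)    = here eq
    restriction-∈ px (here eq)   (miss ¬py _) = contradiction (P-resp eq px) ¬py
    restriction-∈ px (there x∈)  (hit _ r)    = there (restriction-∈ px x∈ r)
    restriction-∈ px (there x∈)  (miss _ r)   = restriction-∈ px x∈ r

  unique-count : ∀ {xs x} → Unique xs → x ∈ xs → Count (x ≈_) xs 1
  unique-count (y≉ ∷ _) (here x≈y) = hit x≈y (count-none (All.map (λ y≉z x≈z → y≉z (trans (sym x≈y) x≈z)) y≉))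
  unique-count (y≉ ∷ u) (there x∈) =
    miss (λ x≈y → All.All¬⇒¬Any (All.map (λ y≉z x≈z → y≉z (trans (sym x≈y) x≈z)) y≉) x∈) (unique-count u x∈)

  unique-reverse : ∀ {xs} → Unique xs → Unique (reverse xs)
  unique-reverse {[]}     []       = []
  unique-reverse {x ∷ xs} (x≉ ∷ u) rewrite List.unfold-reverse x xs =
    AllPairs.++⁺ (unique-reverse u) ([] ∷ [])
      (All.map (λ x≉y → (λ y≈x → x≉y (sym y≈x)) ∷ []) (all-reverse x≉))

  unique-++ˡ : ∀ xs {ys} → Unique (xs ++ ys) → Unique xs
  unique-++ˡ []       _        = []
  unique-++ˡ (x ∷ xs) (x≉ ∷ u) = All.++⁻ˡ xs x≉ ∷ unique-++ˡ xs u

  unique-++ʳ : ∀ xs {ys} → Unique (xs ++ ys) → Unique ys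
  unique-++ʳ []       u       = u
  unique-++ʳ (x ∷ xs) (_ ∷ u) = unique-++ʳ xs u

  unique-disjoint : ∀ xs {ys x} → Unique (xs ++ ys) → x ∈ xs → x ∈ ys → ⊥
  unique-disjoint (x ∷ xs) (x≉ ∷ u) (here y≈x) y∈ys =
    All.All¬⇒¬Any (All.map (λ x≉z y≈z → x≉z (trans (sym y≈x) y≈z)) (All.++⁻ʳ xs x≉)) y∈ys
  unique-disjoint (x ∷ xs) (_ ∷ u)  (there x∈) y∈ys = unique-disjoint xs u x∈ y∈ys

  private
    -- A head `u` of a nonempty `us` would open the left-hand list and close the right-hand one. All
    -- other entries of the right-hand list differ from `u`, and with at least two entries in total
    -- one of these stands first there.
    prefix-empty : ∀ us vs ws → Unique (us ++ vs ++ ws) → 2 ≤ length (us ++ vs ++ ws) →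
                   us ++ vs ++ ws ≋ reverse ws ++ vs ++ reverse us → us ≡ []
    prefix-empty []       vs ws _        _       _  = ≡.refl
    prefix-empty (u ∷ us) vs ws (u≉ ∷ _) (s≤s h) eq =
      ⊥-elim (absurd (reverse ws ++ vs ++ reverse us) others (≋-trans eq (≋-reflexive split)))
      where
      split : reverse ws ++ vs ++ reverse (u ∷ us) ≡ (reverse ws ++ vs ++ reverse us) ++ u ∷ []
      split rewrite List.unfold-reverse u us
                  | List.++-assoc (reverse ws) (vs ++ reverse us) (u ∷ [])
                  | List.++-assoc vs (reverse us) (u ∷ []) = ≡.refl
      others : All (λ x → ¬ u ≈ x) (reverse ws ++ vs ++ reverse us)
      others = All.++⁺ (all-reverse (All.++⁻ʳ vs (All.++⁻ʳ us u≉)))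
        (All.++⁺ (All.++⁻ˡ vs (All.++⁻ʳ us u≉)) (all-reverse (All.++⁻ˡ us u≉)))
      absurd : ∀ xs → All (λ x → ¬ u ≈ x) xs → u ∷ us ++ vs ++ ws ≋ xs ++ u ∷ [] → ⊥
      absurd []       _         eq with _ ∷ e ← eq =
        contradiction (≡.subst (1 ≤_) (≋-length e) h) λ ()
      absurd (x ∷ xs) (u≉x ∷ _) (u≈x ∷ _) = u≉x u≈x

    reverse-++₃ : ∀ (us vs ws : List C) → reverse (us ++ vs ++ ws) ≡ reverse ws ++ reverse vs ++ reverse us
    reverse-++₃ us vs ws rewrite List.reverse-++ us (vs ++ ws) | List.reverse-++ vs ws =
      List.++-assoc (reverse ws) (reverse vs) (reverse us)

  -- Applied to what the prefix, block and tail of one arc contribute to the block of another: if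
  -- reversing the middle part reverses everything, then nothing lies outside the middle. The
  -- equation rearranges to the form of `prefix-empty`.
  reversing-block : ∀ us vs ws → Unique (us ++ vs ++ ws) → 2 ≤ length (us ++ vs ++ ws) →
                    us ++ vs ++ ws ≋ reverse (us ++ reverse vs ++ ws) → us ≡ [] × ws ≡ []
  reversing-block us vs ws u h eq = prefix-empty us vs ws u h eq′ , ws≡[]
    where
    eq′ : us ++ vs ++ ws ≋ reverse ws ++ vs ++ reverse us
    eq′ = ≋-trans eq (≋-reflexive (≡.trans (reverse-++₃ us (reverse vs) ws)
      (≡.cong (λ l → reverse ws ++ l ++ reverse us) (List.reverse-involutive vs))))
    rev = reverse-++₃ us vs ws
    ws≡[] : ws ≡ []
    -- Reversing both sides gives an equation of the same form in which `reverse ws` comes first.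
    ws≡[] with e ← prefix-empty (reverse ws) (reverse vs) (reverse us)
                     (≡.subst Unique rev (unique-reverse u))
                     (≡.subst (2 ≤_) (≡.trans (≡.sym (List.length-reverse (us ++ vs ++ ws))) (≡.cong length rev)) h)
                     (≋-trans (≋-reflexive (≡.sym rev)) (≋-trans (reverse⁺ eq′)
                       (≋-reflexive (reverse-++₃ (reverse ws) vs (reverse us)))))
      = ≡.trans (≡.sym (List.reverse-involutive ws)) (≡.cong reverse e)

  unique-palindrome : ∀ {xs} → Unique xs → xs ≋ reverse xs → length xs ≤ 1
  unique-palindrome {[]}         _ _  = z≤n
  unique-palindrome {x ∷ []}     _ _  = s≤s z≤n
  unique-palindrome {x ∷ y ∷ xs} u eq =
    contradiction (prefix-empty (x ∷ y ∷ xs) [] [] (≡.subst Unique (≡.sym id≡) u)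
      (s≤s (s≤s z≤n)) (≋-trans (≋-reflexive id≡) eq)) λ ()
    where id≡ = List.++-identityʳ (x ∷ y ∷ xs)

-- Reflections and the inversion cocycle.

module Inversions {g ℓ : Level} (X : CoxeterGroup g ℓ) where

  open CoxeterGroup X hiding (refl; sym; trans) public
  open Coxeter X using (conj; product) public
  open Setoid setoid using (refl; sym; trans) public
  open GroupProperties W public using (∙-cancelˡ; ∙-cancelʳ; inverseˡ-unique; //-rightDividesˡ; //-rightDividesʳ)
  open SetoidLists setoid public
  private module P = Presentation (CoxeterRelator matrix)
  open P using () renaming (_≋_ to _≡ᴾ_)
  open import Relation.Binary.Reasoning.Setoid setoid

  conj-cong : ∀ {h k x y} → h ≈ k → x ≈ y → conj h x ≈ conj k y
  conj-cong h≈k x≈y = ∙-cong (∙-cong h≈k x≈y) (⁻¹-cong h≈k)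

  conj-congˡ : ∀ h {x y} → x ≈ y → conj h x ≈ conj h y
  conj-congˡ h = conj-cong refl

  conj-∙-comm : ∀ h x → conj h x ∙ h ≈ h ∙ x
  conj-∙-comm h x = //-rightDividesˡ h (h ∙ x)

  conj-unique : ∀ {h x y} → y ∙ h ≈ h ∙ x → conj h x ≈ y
  conj-unique {h} {x} {y} eq = trans (∙-congʳ (sym eq)) (//-rightDividesʳ h y)

  conj-ε : ∀ x → conj ε x ≈ x
  conj-ε x = conj-unique (trans (identityʳ x) (sym (identityˡ x)))

  conj-∙ : ∀ h k x → conj (h ∙ k) x ≈ conj h (conj k x)
  conj-∙ h k x = conj-unique (begin
    conj h (conj k x) ∙ (h ∙ k) ≈⟨ assoc _ _ _ ⟨
    conj h (conj k x) ∙ h ∙ k   ≈⟨ ∙-congʳ (conj-∙-comm h _) ⟩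
    h ∙ conj k x ∙ k            ≈⟨ assoc _ _ _ ⟩
    h ∙ (conj k x ∙ k)          ≈⟨ ∙-congˡ (conj-∙-comm k x) ⟩
    h ∙ (k ∙ x)                 ≈⟨ assoc _ _ _ ⟨
    h ∙ k ∙ x                   ∎)

  conj-homo-∙ : ∀ h x y → conj h (x ∙ y) ≈ conj h x ∙ conj h y
  conj-homo-∙ h x y = conj-unique (begin
    conj h x ∙ conj h y ∙ h   ≈⟨ assoc _ _ _ ⟩
    conj h x ∙ (conj h y ∙ h) ≈⟨ ∙-congˡ (conj-∙-comm h y) ⟩
    conj h x ∙ (h ∙ y)        ≈⟨ assoc _ _ _ ⟨
    conj h x ∙ h ∙ y          ≈⟨ ∙-congʳ (conj-∙-comm h x) ⟩
    h ∙ x ∙ y                 ≈⟨ assoc _ _ _ ⟩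
    h ∙ (x ∙ y)               ∎)

  conj-identity : ∀ h → conj h ε ≈ ε
  conj-identity h = conj-unique (trans (identityˡ h) (sym (identityʳ h)))

  conj-inverse : ∀ {h k} x → h ∙ k ≈ ε → conj h (conj k x) ≈ x
  conj-inverse {h} {k} x hk≈ε = trans (sym (conj-∙ h k x)) (trans (conj-cong hk≈ε refl) (conj-ε x))

  conj-injective : ∀ h {x y} → conj h x ≈ conj h y → x ≈ y
  conj-injective h {x} {y} eq = ∙-cancelˡ h x y (∙-cancelʳ (h ⁻¹) _ _ eq)

  ev : Term S → Carrier
  ev = eval W gen

  private module Iso = GroupMorphisms.IsGroupIsomorphism presented

  gen-involutive : ∀ s → gen s ∙ gen s ≈ ε
  gen-involutive s = trans (sym (identityʳ _)) (Iso.⟦⟧-cong (P.relator (relator (CoxeterMatrix.diagonal matrix s))))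

  conj-gen-involutive : ∀ s x → conj (gen s) (conj (gen s) x) ≈ x
  conj-gen-involutive s x = conj-inverse x (gen-involutive s)

  conj-self : ∀ x → conj x x ≈ x
  conj-self x = conj-unique refl

  -- The inversion cocycle: on a word a₁…aₖ it is the list of the
  -- reflections (a₁…aᵢ₋₁) aᵢ (a₁…aᵢ₋₁)⁻¹. Signs are irrelevant, as only
  -- parities of multiplicities are invariant under the relations.
  inversions : Term S → List Carrier
  inversions (var s) = gen s ∷ []
  inversions (x · y) = inversions x ++ map (conj (ev x)) (inversions y)
  inversions 𝟏       = []
  inversions (x ⁻)   = map (conj (ev x ⁻¹)) (inversions x)

  infix 4 _~_

  -- Equality in the free 𝔽₂-module on the elements of `W`. It quantifies over all counts because a
  -- multiplicity cannot be computed from the list.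
  _~_ : Rel (List Carrier) _
  xs ~ ys = ∀ r k l → Count (r ≈_) xs k → Count (r ≈_) ys l → parity k ≡ parity l

  map-conj-cong : ∀ {h k xs ys} → h ≈ k → xs ≋ ys → map (conj h) xs ≋ map (conj k) ys
  map-conj-cong h≈k []         = []
  map-conj-cong h≈k (eq ∷ eqs) = conj-cong h≈k eq ∷ map-conj-cong h≈k eqs

  map-conj-∙ : ∀ h k xs → map (conj (h ∙ k)) xs ≋ map (conj h) (map (conj k) xs)
  map-conj-∙ h k []       = []
  map-conj-∙ h k (x ∷ xs) = conj-∙ h k x ∷ map-conj-∙ h k xs

  map-conj-ε : ∀ xs → map (conj ε) xs ≋ xs
  map-conj-ε []       = []
  map-conj-ε (x ∷ xs) = conj-ε x ∷ map-conj-ε xs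

  map-conj-inverse : ∀ {h k} xs → h ∙ k ≈ ε → map (conj h) (map (conj k) xs) ≋ xs
  map-conj-inverse []       eq = []
  map-conj-inverse (x ∷ xs) eq = conj-inverse x eq ∷ map-conj-inverse xs eq

  count-≋ : ∀ {r xs ys k} → xs ≋ ys → Count (r ≈_) xs k → Count (r ≈_) ys k
  count-≋ = count-transfer (λ x≈y r≈x → trans r≈x x≈y) (λ x≈y r≈y → trans r≈y (sym x≈y))

  ≋⇒~ : ∀ {xs ys} → xs ≋ ys → xs ~ ys
  ≋⇒~ eq r _ _ c d = ≡.cong parity (count-unique (count-≋ eq c) d)

  ~-sym : ∀ {xs ys} → xs ~ ys → ys ~ xs
  ~-sym eq r k l c d = ≡.sym (eq r l k d c)

  ~-trans : ∀ {xs ys zs} → xs ~ ys → ys ~ zs → xs ~ zs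
  ~-trans {ys = ys} e f r k l c d = decidable-stable (parity k ℙ.≟ parity l) λ ≢ →
    count-¬¬exists ys λ (j , c′) → ≢ (≡.trans (e r k j c c′) (f r j l c′ d))

  ++-cong-~ : ∀ {xs xs′ ys ys′} → xs ~ xs′ → ys ~ ys′ → xs ++ ys ~ xs′ ++ ys′
  ++-cong-~ {xs} {xs′} e f r _ _ c d
    with k₁ , k₂ , c₁ , c₂ , ≡.refl ← count-++⁻ xs c
       | l₁ , l₂ , d₁ , d₂ , ≡.refl ← count-++⁻ xs′ d
    = ≡.trans (ℙ.+-homo-+ k₁ k₂) (≡.trans (≡.cong₂ ℙ._+_ (e r k₁ l₁ c₁ d₁) (f r k₂ l₂ c₂ d₂)) (≡.sym (ℙ.+-homo-+ l₁ l₂)))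

  double~[] : ∀ {xs ys} → xs ≋ ys → xs ++ ys ~ []
  double~[] {xs} eq r _ _ c []
    with k , l , c₁ , c₂ , ≡.refl ← count-++⁻ xs c
    with ≡.refl ← count-unique (count-≋ eq c₁) c₂
    = ≡.trans (ℙ.+-homo-+ k k) (ℙ.p+p≡0ℙ (parity k))

  count-conj⁻ : ∀ {r k} h xs → Count (r ≈_) (map (conj h) xs) k → Count (conj (h ⁻¹) r ≈_) xs k
  count-conj⁻ h []       []         = []
  count-conj⁻ h (x ∷ xs) (hit eq c) =
    hit (trans (conj-congˡ (h ⁻¹) eq) (conj-inverse x (inverseˡ h))) (count-conj⁻ h xs c)
  count-conj⁻ h (x ∷ xs) (miss ¬eq c) =
    miss (λ eq → ¬eq (trans (sym (conj-inverse _ (inverseʳ h))) (conj-congˡ h eq))) (count-conj⁻ h xs c)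

  map-conj-~ : ∀ {h k xs ys} → h ≈ k → xs ~ ys → map (conj h) xs ~ map (conj k) ys
  map-conj-~ {h} {k} {xs} {ys} h≈k eq = ~-trans
    (λ r i j c d → eq (conj (h ⁻¹) r) i j (count-conj⁻ h xs c) (count-conj⁻ h ys d))
    (≋⇒~ (map-conj-cong h≈k ≋-refl))

  -- The reflection sts⋯s with 2i+1 letters, written as an iterated conjugate because this is the
  -- form in which the cocycle yields the inversions of an alternating word.
  ρ : S → S → ℕ → Carrier
  ρ s t zero    = gen s
  ρ s t (suc i) = conj (gen s) (ρ t s i)

  ρs : S → S → ℕ → List Carrier
  ρs s t = applyUpTo (ρ s t)

  -- The same reflection as a plain product, from which a rotation can be split off on the left.
  reflectionWord : S → S → ℕ → Carrier
  reflectionWord s t zero    = gen s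
  reflectionWord s t (suc i) = gen s ∙ (gen t ∙ reflectionWord s t i)

  -- Both sides are the alternating product of 2i+2 letters that begins with `t`.
  reflectionWord-swap : ∀ s t i → reflectionWord t s i ∙ gen s ≈ gen t ∙ reflectionWord s t i
  reflectionWord-swap s t zero    = refl
  reflectionWord-swap s t (suc i) = begin
    gen t ∙ (gen s ∙ reflectionWord t s i) ∙ gen s   ≈⟨ assoc _ _ _ ⟩
    gen t ∙ (gen s ∙ reflectionWord t s i ∙ gen s)   ≈⟨ ∙-congˡ (assoc _ _ _) ⟩
    gen t ∙ (gen s ∙ (reflectionWord t s i ∙ gen s)) ≈⟨ ∙-congˡ (∙-congˡ (reflectionWord-swap s t i)) ⟩
    gen t ∙ (gen s ∙ (gen t ∙ reflectionWord s t i)) ∎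

  ρ≈reflectionWord : ∀ s t i → ρ s t i ≈ reflectionWord s t i
  ρ≈reflectionWord s t zero    = refl
  ρ≈reflectionWord s t (suc i) = conj-unique (begin
    gen s ∙ (gen t ∙ reflectionWord s t i) ∙ gen s ≈⟨ assoc _ _ _ ⟩
    gen s ∙ (gen t ∙ reflectionWord s t i ∙ gen s) ≈⟨ ∙-congˡ (∙-congʳ (sym (reflectionWord-swap s t i))) ⟩
    gen s ∙ (reflectionWord t s i ∙ gen s ∙ gen s) ≈⟨ ∙-congˡ (assoc _ _ _) ⟩
    gen s ∙ (reflectionWord t s i ∙ (gen s ∙ gen s)) ≈⟨ ∙-congˡ (∙-congˡ (gen-involutive s)) ⟩
    gen s ∙ (reflectionWord t s i ∙ ε)             ≈⟨ ∙-congˡ (identityʳ _) ⟩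
    gen s ∙ reflectionWord t s i                   ≈⟨ ∙-congˡ (ρ≈reflectionWord t s i) ⟨
    gen s ∙ ρ t s i                                ∎)

  ρ-involutive : ∀ s t i → ρ s t i ∙ ρ s t i ≈ ε
  ρ-involutive s t zero    = gen-involutive s
  ρ-involutive s t (suc i) = begin
    conj (gen s) (ρ t s i) ∙ conj (gen s) (ρ t s i) ≈⟨ conj-homo-∙ _ _ _ ⟨
    conj (gen s) (ρ t s i ∙ ρ t s i)                ≈⟨ conj-congˡ _ (ρ-involutive t s i) ⟩
    conj (gen s) ε                                  ≈⟨ conj-identity _ ⟩
    ε                                               ∎

  rotation : S → S → ℕ → Carrier
  rotation s t k = ev ((var s · var t) ^ᵗ k)

  reflectionWord-+ : ∀ s t k i → reflectionWord s t (k + i) ≈ rotation s t k ∙ reflectionWord s t i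
  reflectionWord-+ s t zero    i = sym (identityˡ _)
  reflectionWord-+ s t (suc k) i = begin
    gen s ∙ (gen t ∙ reflectionWord s t (k + i))                ≈⟨ assoc _ _ _ ⟨
    gen s ∙ gen t ∙ reflectionWord s t (k + i)                  ≈⟨ ∙-congˡ (reflectionWord-+ s t k i) ⟩
    gen s ∙ gen t ∙ (rotation s t k ∙ reflectionWord s t i)     ≈⟨ assoc _ _ _ ⟨
    gen s ∙ gen t ∙ rotation s t k ∙ reflectionWord s t i       ∎

  gen∙reflectionWord : ∀ s t j → gen s ∙ reflectionWord t s j ≈ rotation s t (suc j)
  gen∙reflectionWord s t zero    = sym (identityʳ _)
  gen∙reflectionWord s t (suc j) = begin
    gen s ∙ (gen t ∙ (gen s ∙ reflectionWord t s j)) ≈⟨ assoc _ _ _ ⟨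
    gen s ∙ gen t ∙ (gen s ∙ reflectionWord t s j)   ≈⟨ ∙-congˡ (gen∙reflectionWord s t j) ⟩
    gen s ∙ gen t ∙ rotation s t (suc j)             ∎

  -- The first factor ends in `s` and the second begins with `t`, so the product still alternates;
  -- it has 2(i+j+1) letters.
  reflectionWord-∙ : ∀ s t i j → reflectionWord s t i ∙ reflectionWord t s j ≈ rotation s t (i + suc j)
  reflectionWord-∙ s t zero    j = gen∙reflectionWord s t j
  reflectionWord-∙ s t (suc i) j = begin
    gen s ∙ (gen t ∙ reflectionWord s t i) ∙ reflectionWord t s j   ≈⟨ ∙-congʳ (assoc _ _ _) ⟨
    gen s ∙ gen t ∙ reflectionWord s t i ∙ reflectionWord t s j     ≈⟨ assoc _ _ _ ⟩
    gen s ∙ gen t ∙ (reflectionWord s t i ∙ reflectionWord t s j)   ≈⟨ ∙-congˡ (reflectionWord-∙ s t i j) ⟩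
    gen s ∙ gen t ∙ rotation s t (i + suc j)                        ∎

  module _ {s t k} (finite : m s t ≡ [ k ]) where

    rotation-trivial : rotation s t k ≈ ε
    rotation-trivial = Iso.⟦⟧-cong (P.relator (relator finite))

    ρ-periodic : ∀ i → ρ s t (k + i) ≈ ρ s t i
    ρ-periodic i = begin
      ρ s t (k + i)                            ≈⟨ ρ≈reflectionWord s t (k + i) ⟩
      reflectionWord s t (k + i)               ≈⟨ reflectionWord-+ s t k i ⟩
      rotation s t k ∙ reflectionWord s t i    ≈⟨ ∙-congʳ rotation-trivial ⟩
      ε ∙ reflectionWord s t i                 ≈⟨ identityˡ _ ⟩
      reflectionWord s t i                     ≈⟨ ρ≈reflectionWord s t i ⟨
      ρ s t i                                  ∎

    -- The product of the two reflections is the full rotation, which is trivial, and reflections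
    -- are involutions. So exchanging `s` and `t` lists the same reflections in the opposite order.
    ρ-opposite : ∀ i j → i + suc j ≡ k → ρ s t i ≈ ρ t s j
    ρ-opposite i j ≡.refl = ∙-cancelʳ (ρ t s j) _ _ (begin
      ρ s t i ∙ ρ t s j                              ≈⟨ ∙-cong (ρ≈reflectionWord s t i) (ρ≈reflectionWord t s j) ⟩
      reflectionWord s t i ∙ reflectionWord t s j    ≈⟨ reflectionWord-∙ s t i j ⟩
      rotation s t k                                 ≈⟨ rotation-trivial ⟩
      ε                                              ≈⟨ ρ-involutive t s j ⟨
      ρ t s j ∙ ρ t s j                              ∎)

  -- Invariance of the inversions modulo 2.

  applyUpTo-cong : ∀ {f h : ℕ → Carrier} → (∀ i → f i ≈ h i) → ∀ n → applyUpTo f n ≋ applyUpTo h n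
  applyUpTo-cong eq zero    = []
  applyUpTo-cong eq (suc n) = eq 0 ∷ applyUpTo-cong (eq ∘ suc) n

  applyUpTo-+ : ∀ (f : ℕ → Carrier) k n → applyUpTo f (k + n) ≡ applyUpTo f k ++ applyUpTo (λ i → f (k + i)) n
  applyUpTo-+ f zero    n = ≡.refl
  applyUpTo-+ f (suc k) n = ≡.cong (f 0 ∷_) (applyUpTo-+ (f ∘ suc) k n)

  inversions-rotation : ∀ s t k → inversions ((var s · var t) ^ᵗ k) ≋ ρs s t (k * 2)
  inversions-rotation s t zero    = []
  inversions-rotation s t (suc k) = refl ∷ refl ∷ ≋-trans
    (map-conj-cong refl (inversions-rotation s t k))
    (≋-trans (≋-reflexive (List.map-applyUpTo (ρ s t) (conj (gen s ∙ gen t)) (k * 2)))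
      (applyUpTo-cong (λ i → conj-∙ (gen s) (gen t) (ρ s t i)) (k * 2)))

  -- The relator yields 2k reflections, and by periodicity the second half repeats the first, so
  -- every multiplicity is even.
  relator-inversions : ∀ {r} → CoxeterRelator matrix r → inversions r ~ []
  relator-inversions (relator {s} {t} {k} finite) = ~-trans
    (≋⇒~ (≋-trans (inversions-rotation s t k) (≋-reflexive halves)))
    (double~[] (applyUpTo-cong (λ i → sym (ρ-periodic finite i)) k))
    where
    halves : ρs s t (k * 2) ≡ ρs s t k ++ applyUpTo (λ i → ρ s t (k + i)) k
    halves rewrite ℕ.*-comm k 2 | ℕ.+-identityʳ k = applyUpTo-+ (ρ s t) k k

  -- Induction on the derivation. Associativity and the identity laws hold entry by entry by the
  -- cocycle rule; inverses and relators produce a list followed by a copy of itself, which vanishes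
  -- modulo 2.
  inversions-~ : ∀ {x y} → x ≡ᴾ y → inversions x ~ inversions y
  inversions-~ P.≋-refl         = ≋⇒~ ≋-refl
  inversions-~ (P.≋-sym e)      = ~-sym (inversions-~ e)
  inversions-~ (P.≋-trans e f)  = ~-trans (inversions-~ e) (inversions-~ f)
  inversions-~ (P.·-cong e f)   = ++-cong-~ (inversions-~ e) (map-conj-~ (Iso.⟦⟧-cong e) (inversions-~ f))
  inversions-~ (P.⁻-cong e)     = map-conj-~ (⁻¹-cong (Iso.⟦⟧-cong e)) (inversions-~ e)
  inversions-~ (P.assoc x y z)  = ≋⇒~ (≋-trans
    (≋-reflexive (List.++-assoc (inversions x) _ _))
    (++⁺ˡ (inversions x) (≋-trans (++⁺ˡ (map (conj (ev x)) (inversions y)) (map-conj-∙ (ev x) (ev y) (inversions z)))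
      (≋-reflexive (≡.sym (List.map-++ (conj (ev x)) (inversions y) _))))))
  inversions-~ (P.identityˡ x)  = ≋⇒~ (map-conj-ε (inversions x))
  inversions-~ (P.identityʳ x)  = ≋⇒~ (≋-reflexive (List.++-identityʳ (inversions x)))
  inversions-~ (P.inverseˡ x)   = double~[] {map (conj (ev x ⁻¹)) (inversions x)} ≋-refl
  inversions-~ (P.inverseʳ x)   = double~[] (≋-sym (map-conj-inverse (inversions x) (inverseʳ (ev x))))
  inversions-~ (P.relator r)    = relator-inversions r

  -- Injectivity of the presentation isomorphism turns an equality in `W` into a derivation from the
  -- Coxeter relations.
  inversions-invariant : ∀ {x y} → ev x ≈ ev y → inversions x ~ inversions y
  inversions-invariant {x} {y} eq = inversions-~ {x} {y} (Iso.injective eq)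

-- Inversions of words and of reduced words.

module Words {g ℓ : Level} (X : CoxeterGroup g ℓ) where

  open Inversions X public
  open import Relation.Binary.Reasoning.Setoid setoid

  term : List S → Term S
  term []      = 𝟏
  term (x ∷ a) = var x · term a

  ev-term : ∀ a → ev (term a) ≡ product a
  ev-term []      = ≡.refl
  ev-term (x ∷ a) = ≡.cong (gen x ∙_) (ev-term a)

  ev-++ : ∀ a b → ev (term (a ++ b)) ≈ ev (term a) ∙ ev (term b)
  ev-++ []      b = sym (identityˡ _)
  ev-++ (x ∷ a) b = trans (∙-congˡ (ev-++ a b)) (sym (assoc _ _ _))

  inv : List S → List Carrier
  inv a = inversions (term a)

  inv-++ : ∀ a b → inv (a ++ b) ≋ inv a ++ map (conj (ev (term a))) (inv b)
  inv-++ []      b = ≋-sym (map-conj-ε (inv b))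
  inv-++ (x ∷ a) b = refl ∷ ≋-trans (map-conj-cong refl (inv-++ a b))
    (≋-trans (≋-reflexive (List.map-++ (conj (gen x)) (inv a) _))
      (++⁺ˡ (map (conj (gen x)) (inv a)) (≋-sym (map-conj-∙ (gen x) (ev (term a)) (inv b)))))

  inv-alternating : ∀ n s t → inv (alternating n s t) ≡ ρs s t n
  inv-alternating zero    s t = ≡.refl
  inv-alternating (suc n) s t = ≡.cong (gen s ∷_)
    (≡.trans (≡.cong (map (conj (gen s))) (inv-alternating n t s)) (List.map-applyUpTo (ρ t s) (conj (gen s)) n))

  ev-alternating-odd : ∀ i s t → ev (term (alternating (suc (i * 2)) s t)) ≈ ρ s t i
  ev-alternating-odd i s t = trans (go i) (sym (ρ≈reflectionWord s t i))
    where
    go : ∀ i → ev (term (alternating (suc (i * 2)) s t)) ≈ reflectionWord s t i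
    go zero    = identityʳ _
    go (suc i) = ∙-congˡ (∙-congˡ (go i))

  -- If `r` is the inversion of the i-th letter, then `b` is `a` without that letter: multiplying by
  -- `r` on the left puts the letter back.
  deletion : ∀ a {r} → r ∈ inv a →
             ∃[ b ] length a ≡ suc (length b) × ev (term a) ≈ r ∙ ev (term b)
  deletion (x ∷ a) (here r≈x)      = a , ≡.refl , ∙-congʳ (sym r≈x)
  deletion (x ∷ a) {r} (there r∈)
    with r′ , r′∈ , r≈ ← Membership.∈-map⁻ setoid setoid r∈
    with b , len , eq ← deletion a r′∈
    = x ∷ b , ≡.cong suc len , (begin
      gen x ∙ ev (term a)                     ≈⟨ ∙-congˡ eq ⟩
      gen x ∙ (r′ ∙ ev (term b))              ≈⟨ assoc _ _ _ ⟨
      gen x ∙ r′ ∙ ev (term b)                ≈⟨ ∙-congʳ (conj-∙-comm _ _) ⟨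
      conj (gen x) r′ ∙ gen x ∙ ev (term b)   ≈⟨ ∙-congʳ (∙-congʳ r≈) ⟨
      r ∙ gen x ∙ ev (term b)                 ≈⟨ assoc _ _ _ ⟩
      r ∙ (gen x ∙ ev (term b))               ∎)

  Minimal : List S → Set ℓ
  Minimal a = ∀ b → ev (term b) ≈ ev (term a) → length a ≤ length b

  -- If `gen x` occurred again, it would be `conj (gen x) r` for some `r` in `inv a`, which forces
  -- `r` to be `gen x`. Deleting the letter of `r` and cancelling it against the leading `x` would
  -- then give a word shorter by two.
  minimal-unique : ∀ a → Minimal a → Unique (inv a)
  minimal-unique []      min = []
  minimal-unique (x ∷ a) min =
    Membership.∉⇒All[≉] setoid fresh ∷ AllPairs.map⁺ (AllPairs.map (λ ≉ → ≉ ∘ conj-injective (gen x)) (minimal-unique a tail))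
    where
    tail : Minimal a
    tail b eq = s≤s⁻¹ (min (x ∷ b) (∙-congˡ eq))
    fresh : ¬ (gen x ∈ map (conj (gen x)) (inv a))
    fresh x∈
      with r , r∈ , x≈ ← Membership.∈-map⁻ setoid setoid x∈
      with b , len , eq ← deletion a r∈
      = ℕ.1+n≰n (ℕ.≤-trans (ℕ.n≤1+n _) (≡.subst (λ l → suc l ≤ length b) len (min b (begin
        ev (term b)                     ≈⟨ identityˡ _ ⟨
        ε ∙ ev (term b)                 ≈⟨ ∙-congʳ (gen-involutive x) ⟨
        gen x ∙ gen x ∙ ev (term b)     ≈⟨ assoc _ _ _ ⟩
        gen x ∙ (gen x ∙ ev (term b))   ≈⟨ ∙-congˡ (∙-congʳ (conj-injective (gen x) (trans (conj-self _) x≈))) ⟩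
        gen x ∙ (r ∙ ev (term b))       ≈⟨ ∙-congˡ eq ⟨
        gen x ∙ ev (term a)             ∎))))

  -- Dihedral reflections and the projection to a coset.

  Finite : ℕ → S → S → Set
  Finite k s t = m s t ≡ [ k ]

  finite-swap : ∀ {k s t} → Finite k s t → Finite k t s
  finite-swap = ≡.trans (CoxeterMatrix.symmetric matrix _ _)

  applyUpTo≋applyDownFrom : ∀ {f h : ℕ → Carrier} n → (∀ i j → i + suc j ≡ n → h i ≈ f j) →
                            applyUpTo h n ≋ applyDownFrom f n
  applyUpTo≋applyDownFrom zero    eq = []
  applyUpTo≋applyDownFrom (suc n) eq =
    eq 0 n ≡.refl ∷ applyUpTo≋applyDownFrom n (λ i j e → eq (suc i) j (≡.cong suc e))

  ρs-reverse : ∀ {k s t} → Finite k s t → ρs t s k ≋ reverse (ρs s t k)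
  ρs-reverse {k} {s} {t} finite = ≋-trans
    (applyUpTo≋applyDownFrom k (ρ-opposite (finite-swap finite)))
    (≋-reflexive (≡.sym (List.reverse-applyUpTo (ρ s t) k)))

  ρs-unique-swap : ∀ {k s t} → Finite k s t → Unique (ρs s t k) → Unique (ρs t s k)
  ρs-unique-swap finite u = Unique-resp-≋ (≋-sym (ρs-reverse finite)) (unique-reverse u)

  allPairs-applyUpTo⁻ : ∀ {R : Rel Carrier ℓ} (f : ℕ → Carrier) {n i j} → AllPairs R (applyUpTo f n) →
                        i < j → j < n → R (f i) (f j)
  allPairs-applyUpTo⁻ f {suc n} {zero}  {suc j} (rs ∷ _) _         (s≤s j<n) = All.applyUpTo⁻ (f ∘ suc) n rs j<n
  allPairs-applyUpTo⁻ f {suc n} {suc i} {suc j} (_ ∷ rs) (s≤s i<j) (s≤s j<n) = allPairs-applyUpTo⁻ (f ∘ suc) rs i<j j<n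

  ρs-unique-≤ : ∀ {k s t} → Unique (ρs s t k) → ∀ {n} → n ≤ k → Unique (ρs s t n)
  ρs-unique-≤ {s = s} {t} u {n} n≤k = AllPairs.applyUpTo⁺₁ (ρ s t) n λ i<j j<n →
    allPairs-applyUpTo⁻ (ρ s t) u i<j (ℕ.<-≤-trans j<n n≤k)

  -- For `m s t ≡ [ k ]` these are the reflections of the dihedral group ⟨s,t⟩. Indexing them avoids
  -- speaking of the subgroup itself.
  DihedralReflection : ℕ → S → S → Carrier → Set ℓ
  DihedralReflection k s t r = ∃[ i ] i < k × r ≈ ρ s t i

  dihedral-resp : ∀ {k s t} → DihedralReflection k s t Respects _≈_
  dihedral-resp x≈y (i , i<k , eq) = i , i<k , trans (sym x≈y) eq

  dihedral-swap : ∀ {k s t r} → Finite k s t → DihedralReflection k s t r → DihedralReflection k t s r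
  dihedral-swap finite (i , i<k , eq) with j , ≡.refl ← ℕ.m≤n⇒∃[o]m+o≡n i<k =
    j , s≤s (ℕ.m≤n+m j i) , trans eq (ρ-opposite finite i j (ℕ.+-suc i j))

  dihedral-conj₁ : ∀ {k s t r} → Finite k s t → DihedralReflection k s t r →
                   DihedralReflection k s t (conj (gen s) r)
  dihedral-conj₁ finite (zero  , 0<k , eq) = 0 , 0<k , trans (conj-congˡ _ eq) (conj-self _)
  dihedral-conj₁ finite (suc i , i<k , eq) = dihedral-swap (finite-swap finite)
    (i , ℕ.<-trans (ℕ.n<1+n i) i<k , trans (conj-congˡ _ eq) (conj-gen-involutive _ _))

  dihedral-conj₂ : ∀ {k s t r} → Finite k s t → DihedralReflection k s t r →
                   DihedralReflection k s t (conj (gen t) r)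
  dihedral-conj₂ finite = dihedral-swap (finite-swap finite) ∘ dihedral-conj₁ (finite-swap finite) ∘ dihedral-swap finite

  dihedral-conj-alternating : ∀ n {k s t r} → Finite k s t → DihedralReflection k s t r →
                              DihedralReflection k s t (conj (ev (term (alternating n s t))) r)
  dihedral-conj-alternating zero    finite d = dihedral-resp (sym (conj-ε _)) d
  dihedral-conj-alternating (suc n) finite d = dihedral-resp (sym (conj-∙ _ _ _)) (dihedral-conj₁ finite
    (dihedral-swap (finite-swap finite) (dihedral-conj-alternating n (finite-swap finite) (dihedral-swap finite d))))

  -- y⁻¹ is the minimal representative of its coset of ⟨s,t⟩: no wall of ⟨s,t⟩
  -- separates it from the identity.
  Gate : ℕ → S → S → Term S → Set _
  Gate k s t y = ∀ r → DihedralReflection k s t r → ∀ n → Count (r ≈_) (inversions y) n → parity n ≡ 0ℙ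

  gate-swap : ∀ {k s t y} → Finite k s t → Gate k s t y → Gate k t s y
  gate-swap finite gate r d = gate r (dihedral-swap (finite-swap finite) d)

  -- The word r = (s,t,…,s) of length 2i+1 crosses the wall of s once, and so does
  -- r y; but r y = y x, which by the gate condition crosses only the wall of r.
  crossed-wall-half : ∀ {k s t y x i} → Finite k s t → Unique (ρs s t k) → Gate k s t y → i * 2 < k →
                      conj (ev y) (gen x) ≈ ρ s t i → ¬ ¬ (conj (ev y) (gen x) ≈ gen s)
  crossed-wall-half {k} {s} {t} {y} {x} {i} finite unique gate 2i<k eq ≉s =
    count-¬¬exists (inversions y) λ (n , c) →
    count-¬¬exists (map (conj (ev v)) (inversions y)) λ (n′ , c′) → odd≢even
      (≡.trans (≡.sym (≡.trans (ℙ.+-homo-+ 1 n′) (≡.cong (1ℙ ℙ.+_) (gate _ s-conj n′ (count-conj⁻ (ev v) (inversions y) c′)))))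
      (≡.trans (inversions-invariant {v · y} {y · var x} products (gen s) (1 + n′) (n + 0)
                 (count-++⁺ once c′) (count-++⁺ c (miss (≉s ∘ sym) [])))
      (≡.trans (≡.cong parity (ℕ.+-identityʳ n)) (gate (gen s) s-refl n c))))
    where
    v = term (alternating (suc (i * 2)) s t)
    odd≢even : 1ℙ ≢ 0ℙ
    odd≢even ()
    s-refl : DihedralReflection k s t (gen s)
    s-refl = 0 , ℕ.≤-<-trans z≤n 2i<k , refl
    once : Count (gen s ≈_) (inversions v) 1
    once with fresh ∷ _ ← ≡.subst Unique (≡.sym (inv-alternating (suc (i * 2)) s t)) (ρs-unique-≤ unique 2i<k)
      = hit refl (count-none fresh)
    products : ev (v · y) ≈ ev (y · var x)
    products = begin
      ev v ∙ ev y                   ≈⟨ ∙-congʳ (ev-alternating-odd i s t) ⟩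
      ρ s t i ∙ ev y                ≈⟨ ∙-congʳ eq ⟨
      conj (ev y) (gen x) ∙ ev y    ≈⟨ conj-∙-comm _ _ ⟩
      ev y ∙ gen x                  ∎
    v-involutive : ev v ≈ ev v ⁻¹
    v-involutive = inverseˡ-unique _ _ (trans (∙-cong (ev-alternating-odd i s t) (ev-alternating-odd i s t)) (ρ-involutive s t i))
    s-conj : DihedralReflection k s t (conj (ev v ⁻¹) (gen s))
    s-conj = dihedral-resp (conj-cong v-involutive refl) (dihedral-conj-alternating (suc (i * 2)) finite s-refl)

  -- The reflection has index i with respect to `s`, `t` and index j = k - 1 - i with respect to
  -- `t`, `s`. At least one of these lies below k/2, as `crossed-wall-half` requires, and it decides
  -- which generator is met.
  crossed-wall : ∀ {k s t y x} → Finite k s t → Unique (ρs s t k) → Gate k s t y →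
                 DihedralReflection k s t (conj (ev y) (gen x)) →
                 ¬ ¬ (conj (ev y) (gen x) ≈ gen s ⊎ conj (ev y) (gen x) ≈ gen t)
  crossed-wall {k} {s} {t} {y} {x} finite unique gate (i , i<k , eq) ¬goal
    with j , ≡.refl ← ℕ.m≤n⇒∃[o]m+o≡n i<k | i * 2 ℕ.<? k
  ... | yes 2i<k = crossed-wall-half {y = y} {x} {i} finite unique gate 2i<k eq (¬goal ∘ inj₁)
  ... | no 2i≮k  = crossed-wall-half {y = y} {x} {j} (finite-swap finite) (ρs-unique-swap finite unique)
    (gate-swap {y = y} finite gate) 2j<k (trans eq (ρ-opposite finite i j (ℕ.+-suc i j))) (¬goal ∘ inj₂)
    where
    double : ∀ n → n * 2 ≡ n + n
    double n = ≡.trans (ℕ.*-comm n 2) (≡.cong (n +_) (ℕ.+-identityʳ n))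
    j<i : j < i
    j<i = ℕ.+-cancelˡ-≤ i (suc j) i (≡.subst₂ _≤_ (≡.sym (ℕ.+-suc i j)) (double i) (ℕ.≮⇒≥ 2i≮k))
    2j<k : j * 2 < suc i + j
    2j<k = ≡.subst (_< suc i + j) (≡.sym (double j)) (ℕ.+-monoˡ-< j (ℕ.<-trans j<i (ℕ.n<1+n i)))

  -- Conjugation by `s` turns `ρs t s n` into the tail of `ρs s t (suc n)`. If instead the rest
  -- began with `gen s`, conjugation would fix that entry and it would repeat the head.
  extend-ρs : ∀ {s t x xs n} → x ≈ gen s → Unique (x ∷ map (conj (gen s)) xs) →
              xs ≋ ρs s t n ⊎ xs ≋ ρs t s n → ∃[ n′ ] x ∷ map (conj (gen s)) xs ≋ ρs s t n′
  extend-ρs x≈s _ (inj₂ eqs) = _ , x≈s ∷ ≋-trans (map-conj-cong refl eqs) (≋-reflexive (List.map-applyUpTo _ _ _))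
  extend-ρs {n = zero}  x≈s _ (inj₁ []) = 1 , x≈s ∷ []
  extend-ρs {n = suc n} x≈s ((x≉ ∷ _) ∷ _) (inj₁ (y≈s ∷ _)) =
    contradiction (trans x≈s (trans (sym (conj-self _)) (conj-congˡ _ (sym y≈s)))) x≉

  -- Along the path of a word b, the projection to the coset of ⟨s,t⟩ moves only at
  -- the walls of ⟨s,t⟩, and each time to a neighbour.
  trace : ∀ {k s t} → Finite k s t → Unique (ρs s t k) → ∀ b y {xs} → Gate k s t y →
          Restriction (DihedralReflection k s t) (map (conj (ev y)) (inv b)) xs → Unique xs →
          ¬ ¬ (∃[ n ] (xs ≋ ρs s t n ⊎ xs ≋ ρs t s n))
  trace finite unique [] y gate [] _ ¬goal = ¬goal (0 , inj₁ [])
  -- The letter crosses no wall of ⟨s,t⟩, so the projection stays put. The gate moves on to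
  -- `y · var x`, whose one additional inversion is not a wall of ⟨s,t⟩.
  trace {k} {s} {t} finite unique (x ∷ b) y {xs} gate (miss ¬d res) u ¬goal
    with ys , xs≋ys , res′ ← restriction-≋ dihedral-resp (≋-sym (map-conj-∙ (ev y) (gen x) (inv b))) res
    = trace finite unique b (y · var x) gate′ res′ (Unique-resp-≋ xs≋ys u) λ where
        (n , inj₁ e) → ¬goal (n , inj₁ (≋-trans xs≋ys e))
        (n , inj₂ e) → ¬goal (n , inj₂ (≋-trans xs≋ys e))
    where
    gate′ : Gate k s t (y · var x)
    gate′ r d n c with count-++⁻ (inversions y) c
    ... | j , _ , c₁ , miss _ [] , ≡.refl = ≡.trans (≡.cong parity (ℕ.+-identityʳ j)) (gate r d j c₁)
    ... | _ , _ , _  , hit eq [] , _      = contradiction (dihedral-resp eq d) ¬d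
  -- Here yx = zy with z one of `s`, `t`. The gate `y` is kept and the remaining path is translated
  -- by z, which permutes the walls of ⟨s,t⟩.
  trace {k} {s} {t} finite unique (x ∷ b) y gate (hit {ys = xs} d res) u ¬goal =
    crossed-wall {y = y} finite unique gate d λ where
      (inj₁ ≈s) → step s (dihedral-conj₁ finite) ≈s λ zs≋ u′ (n , e) →
        let n′ , e′ = extend-ρs ≈s u′ e in ¬goal (n′ , inj₁ (≋-trans (refl ∷ zs≋) e′))
      (inj₂ ≈t) → step t (dihedral-conj₂ finite) ≈t λ zs≋ u′ (n , e) →
        let n′ , e′ = extend-ρs ≈t u′ (Sum.swap e) in ¬goal (n′ , inj₂ (≋-trans (refl ∷ zs≋) e′))
    where
    step : ∀ z → (∀ {r} → DihedralReflection k s t r → DihedralReflection k s t (conj (gen z) r)) →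
           conj (ev y) (gen x) ≈ gen z →
           (∀ {zs} → xs ≋ map (conj (gen z)) zs → Unique (conj (ev y) (gen x) ∷ map (conj (gen z)) zs) →
             ¬ (∃[ n ] (zs ≋ ρs s t n ⊎ zs ≋ ρs t s n))) → ⊥
    step z closed eq continue
      with ys , xs≋ys , res′ ← restriction-≋ dihedral-resp (≋-trans (≋-sym (map-conj-∙ (ev y) (gen x) (inv b)))
             (≋-trans (map-conj-cong (trans (sym (conj-∙-comm _ _)) (∙-congʳ eq)) ≋-refl) (map-conj-∙ (gen z) (ev y) (inv b)))) res
      with zs , ≡.refl , res″ ← restriction-map⁻ (map (conj (ev y)) (inv b)) res′
      = trace finite unique b y gate
          (restriction-⇔ (λ d → dihedral-resp (conj-gen-involutive z _) (closed d)) closed res″)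
          unique-zs (continue xs≋ys u′)
      where
      u′ : Unique (conj (ev y) (gen x) ∷ map (conj (gen z)) zs)
      u′ = Unique-resp-≋ (refl ∷ xs≋ys) u
      unique-zs : Unique zs
      unique-zs with _ ∷ u″ ← u′ = AllPairs.map (λ ≉ → ≉ ∘ conj-congˡ (gen z)) (AllPairs.map⁻ u″)

-- Blocks of arcs and the order in which reduced words cross them.

module Arcs {g ℓ : Level} (X : CoxeterGroup g ℓ) where

  open Words X public
  open Coxeter X using (𝔐; _ᵒᵖ; module IsReducedExpression; Vertex; Arc)
  open import Relation.Binary.Reasoning.Setoid setoid

  -- The reflections of q⟨s,t⟩q⁻¹, in the order in which they become inversions along
  -- the alternating word (s,t,…) read after a prefix of product q.
  walls : Carrier → 𝔐 → List Carrier
  walls q P = map (conj q) (ρs fst snd order) where open 𝔐 P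

  walls-length : ∀ q P → length (walls q P) ≡ 𝔐.order P
  walls-length q P = ≡.trans (List.length-map (conj q) (ρs fst snd order)) (List.length-applyUpTo (ρ fst snd) order)
    where open 𝔐 P

  order≥2 : ∀ P → 2 ≤ 𝔐.order P
  order≥2 P with e ← CoxeterMatrix.atLeast2 matrix (𝔐.fst≢snd P) rewrite 𝔐.finite P = [≤]-injective e

  walls-length≥2 : ∀ q P → 2 ≤ length (walls q P)
  walls-length≥2 q P = ≡.subst (2 ≤_) (≡.sym (walls-length q P)) (order≥2 P)

  walls-ᵒᵖ : ∀ q P → walls q (P ᵒᵖ) ≋ reverse (walls q P)
  walls-ᵒᵖ q P = ≋-trans (map-conj-cong refl (ρs-reverse (𝔐.finite P)))
    (≋-reflexive (List.reverse-map (conj q) (ρs (𝔐.fst P) (𝔐.snd P) (𝔐.order P))))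

  module _ {w : Carrier} where

    vertex-ev : (a : Vertex w) → ev (term (proj₁ a)) ≈ w
    vertex-ev (a , red) = trans (reflexive (ev-term a)) (IsReducedExpression.expresses red)

    vertex-unique : (a : Vertex w) → Unique (inv (proj₁ a))
    vertex-unique (a , red) = minimal-unique a λ b eq → IsReducedExpression.minimal red b
      (trans (reflexive (≡.sym (ev-term b))) (trans eq (vertex-ev (a , red))))

    module ArcProperties {a b : Vertex w} (e : Arc a b) where

      open Arc e
      open 𝔐 pair using (order; finite) renaming (fst to s; snd to t) public

      prefix suffix : List S
      prefix = proj₁ move
      suffix = proj₁ (proj₂ move)

      base : Carrier
      base = ev (term prefix)

      Z : List Carrier
      Z = walls base pair

      tail : List Carrier
      tail = map (conj (base ∙ ev (term (alternating order s t)))) (inv suffix)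

      private
        split : ∀ s t → inv (prefix ++ alternating order s t ++ suffix) ≋
                inv prefix ++ map (conj base) (ρs s t order) ++ map (conj (base ∙ ev (term (alternating order s t)))) (inv suffix)
        split s t = ≋-trans (inv-++ prefix _) (++⁺ˡ (inv prefix) (≋-trans
          (map-conj-cong refl (≋-trans (inv-++ (alternating order s t) suffix)
            (≋-reflexive (≡.cong (_++ map (conj (ev (term (alternating order s t)))) (inv suffix)) (inv-alternating order s t)))))
          (≋-trans (≋-reflexive (List.map-++ (conj base) (ρs s t order) _))
            (++⁺ˡ (map (conj base) (ρs s t order)) (≋-sym (map-conj-∙ base _ (inv suffix)))))))

        products : ∀ s t → ev (term (prefix ++ alternating order s t ++ suffix)) ≈
                   base ∙ ev (term (alternating order s t)) ∙ ev (term suffix)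
        products s t = trans (ev-++ prefix _) (trans (∙-congˡ (ev-++ (alternating order s t) suffix)) (sym (assoc _ _ _)))

        source≡ = proj₁ (proj₂ (proj₂ move))
        target≡ = proj₂ (proj₂ (proj₂ move))

      source-inversions : inv (proj₁ a) ≋ inv prefix ++ Z ++ tail
      source-inversions = ≋-trans (≋-reflexive (≡.cong inv source≡)) (split s t)

      target-inversions : inv (proj₁ b) ≋ inv prefix ++ reverse Z ++ tail
      target-inversions = ≋-trans (≋-reflexive (≡.cong inv target≡)) (≋-trans (split t s)
        (++⁺ˡ (inv prefix) (++⁺ (walls-ᵒᵖ base pair) (map-conj-cong (sym same) ≋-refl))))
        where
        -- The tail is unaffected by the move. Both words have product `w`, so the two alternating
        -- products agree by cancelling the suffix.
        same : base ∙ ev (term (alternating order s t)) ≈ base ∙ ev (term (alternating order t s))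
        same = ∙-cancelʳ (ev (term suffix)) _ _ (begin
          base ∙ ev (term (alternating order s t)) ∙ ev (term suffix)   ≈⟨ products s t ⟨
          ev (term (prefix ++ alternating order s t ++ suffix))         ≡⟨ ≡.cong (ev ∘ term) source≡ ⟨
          ev (term (proj₁ a))                                           ≈⟨ vertex-ev a ⟩
          w                                                             ≈⟨ vertex-ev b ⟨
          ev (term (proj₁ b))                                           ≡⟨ ≡.cong (ev ∘ term) target≡ ⟩
          ev (term (prefix ++ alternating order t s ++ suffix))         ≈⟨ products t s ⟩
          base ∙ ev (term (alternating order t s)) ∙ ev (term suffix)   ∎)

      split-unique : Unique (inv prefix ++ Z ++ tail)
      split-unique = Unique-resp-≋ source-inversions (vertex-unique a)

      Z-unique : Unique Z
      Z-unique = unique-++ˡ Z (unique-++ʳ (inv prefix) split-unique)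

      Z-length≥2 : 2 ≤ length Z
      Z-length≥2 = walls-length≥2 base pair

      Z≇reverse : ¬ (Z ≋ reverse Z)
      Z≇reverse eq = contradiction (ℕ.≤-trans Z-length≥2 (unique-palindrome Z-unique eq)) λ { (s≤s ()) }

      private
        unique : Unique (ρs s t order)
        unique = AllPairs.map (λ ≉ → ≉ ∘ conj-congˡ base) (AllPairs.map⁻ Z-unique)

        Reflection : Carrier → Set ℓ
        Reflection = DihedralReflection order s t

        reflection⇒wall : ∀ {r} → Reflection r → conj base r ∈ Z
        reflection⇒wall (i , i<k , eq) = Membership.∈-resp-≈ setoid (conj-congˡ base (sym eq))
          (Membership.∈-map⁺ setoid setoid (conj-congˡ base) (Membership.∈-applyUpTo⁺ setoid (ρ s t) i<k))

        wall⇒reflection : ∀ {r} → r ∈ Z → Reflection (conj (base ⁻¹) r)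
        wall⇒reflection r∈ with r′ , r′∈ , r≈ ← Membership.∈-map⁻ setoid setoid r∈
          with i , i<k , r′≈ ← Membership.∈-applyUpTo⁻ setoid (ρ s t) r′∈
          = i , i<k , trans (conj-congˡ _ r≈) (trans (conj-inverse r′ (inverseˡ base)) r′≈)

        reflection⇒wall′ : ∀ {r} → Reflection (conj (base ⁻¹) r) → r ∈ Z
        reflection⇒wall′ d = Membership.∈-resp-≈ setoid (conj-inverse _ (inverseʳ base)) (reflection⇒wall d)

        -- A wall of ⟨s,t⟩ among these inversions would, after conjugation by `base`, lie both in
        -- `inv prefix` and in `Z`. These are disjoint pieces of a duplicate-free list.
        gate : Gate order s t (term prefix ⁻)
        gate r d n c = ≡.cong parity (count-unique c (count-none (Membership.∉⇒All[≉] setoid λ r∈ →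
          let r′ , r′∈ , r≈ = Membership.∈-map⁻ setoid setoid r∈ in
          unique-disjoint (inv prefix) split-unique
            (Membership.∈-resp-≈ setoid (trans (sym (conj-inverse r′ (inverseʳ base))) (conj-congˡ base (sym r≈))) r′∈)
            (Membership.∈-++⁺ˡ setoid (reflection⇒wall d)))))

        -- The multiplicity of `r` is 1 for the source of `e`, and its parity is the same for every
        -- word with product `w`, so it cannot be 0 for `c`.
        all-crossed : ∀ (c : Vertex w) {r} → r ∈ Z → ¬ ¬ (r ∈ inv (proj₁ c))
        all-crossed c {r} r∈ r∉ = contradiction
          (inversions-invariant {term (proj₁ a)} {term (proj₁ c)} (trans (vertex-ev a) (sym (vertex-ev c))) r 1 0
            (unique-count (vertex-unique a) (Membership.∈-resp-≋ setoid (≋-sym source-inversions)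
              (Membership.∈-++⁺ʳ setoid (inv prefix) (Membership.∈-++⁺ˡ setoid r∈))))
            (count-none (Membership.∉⇒All[≉] setoid r∉))) λ ()

      -- Conjugation by `base ⁻¹` carries `Z` to the reflections of ⟨s,t⟩, where `trace` yields a
      -- run of n reflections in one of the two directions. A run shorter than `order` would leave a
      -- wall uncrossed, and a longer one would repeat its first entry by periodicity.
      walls-order : ∀ (c : Vertex w) {xs} → Restriction (_∈ Z) (inv (proj₁ c)) xs →
                    ¬ ¬ (xs ≋ Z ⊎ xs ≋ reverse Z)
      walls-order c {xs} res ¬goal = trace finite unique (proj₁ c) (term prefix ⁻) gate
        (restriction-map⁺ (restriction-⇔ wall⇒reflection reflection⇒wall′ res)) unique-ys λ where
          (n , inj₁ eq) → ρs-length finite unique (λ d ¬∈ → covered d (¬∈ ∘ Membership.∈-resp-≋ setoid eq)) (Unique-resp-≋ eq unique-ys) λ where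
            ≡.refl → ¬goal (inj₁ (back eq))
          (n , inj₂ eq) → ρs-length (finite-swap finite) (ρs-unique-swap finite unique)
            (λ d ¬∈ → covered (dihedral-swap (finite-swap finite) d) (¬∈ ∘ Membership.∈-resp-≋ setoid eq)) (Unique-resp-≋ eq unique-ys) λ where
            ≡.refl → ¬goal (inj₂ (≋-trans (back eq) (walls-ᵒᵖ base pair)))
        where
        ys = map (conj (base ⁻¹)) xs
        unique-ys : Unique ys
        unique-ys = AllPairs.map⁺ (AllPairs.map (λ ≉ → ≉ ∘ conj-injective (base ⁻¹)) (restriction-AllPairs res (vertex-unique c)))
        back : ∀ {zs} → ys ≋ zs → xs ≋ map (conj base) zs
        back eq = ≋-trans (≋-sym (map-conj-inverse xs (inverseʳ base))) (map-conj-cong refl eq)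
        covered : ∀ {r} → Reflection r → ¬ ¬ (r ∈ ys)
        covered {r} d ¬∈ = all-crossed c (reflection⇒wall d) λ ∈inv → ¬∈
          (Membership.∈-resp-≈ setoid (conj-inverse r (inverseˡ base))
            (Membership.∈-map⁺ setoid setoid (conj-congˡ (base ⁻¹))
              (restriction-∈ (Membership.∈-resp-≈ setoid) (reflection⇒wall d) ∈inv res)))
        ρs-length : ∀ {s t n} → Finite order s t → Unique (ρs s t order) →
                    (∀ {r} → DihedralReflection order s t r → ¬ ¬ (r ∈ ρs s t n)) →
                    Unique (ρs s t n) → ¬ ¬ (n ≡ order)
        ρs-length {s} {t} {n} fin u cov un ≢ with ℕ.<-cmp n order
        ... | tri≈ _ eq _  = ≢ eq
        ... | tri< n<k _ _ = cov (n , n<k , refl) λ ∈ρs →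
          let i , i<n , eq = Membership.∈-applyUpTo⁻ setoid (ρ s t) ∈ρs in
          allPairs-applyUpTo⁻ (ρ s t) u i<n n<k (sym eq)
        ... | tri> _ _ k<n = allPairs-applyUpTo⁻ (ρ s t) un (ℕ.<-≤-trans (s≤s z≤n) (order≥2 pair)) k<n
          (trans (sym (ρ-periodic fin 0)) (reflexive (≡.cong (ρ s t) (ℕ.+-identityʳ order))))

      orient : Bool → List Carrier
      orient true  = Z
      orient false = reverse Z

      -- σ is true when c crosses the walls of e in the order of the source of e.
      Side : Vertex w → Bool → Set _
      Side c σ = ∃[ xs ] Restriction (_∈ Z) (inv (proj₁ c)) xs × xs ≋ orient σ

      side-exists : ∀ c → ¬ ¬ (∃[ σ ] Side c σ)
      side-exists c ¬goal = restriction-¬¬exists (inv (proj₁ c)) λ (xs , res) → walls-order c res λ where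
        (inj₁ eq) → ¬goal (true , xs , res , eq)
        (inj₂ eq) → ¬goal (false , xs , res , eq)

      side-unique : ∀ c {σ τ} → Side c σ → Side c τ → σ ≡ τ
      side-unique _ {true}  {true}  _ _ = ≡.refl
      side-unique _ {false} {false} _ _ = ≡.refl
      side-unique _ {true}  {false} (_ , r , eq) (_ , r′ , eq′) with ≡.refl ← restriction-unique r r′ =
        contradiction (≋-trans (≋-sym eq) eq′) Z≇reverse
      side-unique _ {false} {true}  (_ , r , eq) (_ , r′ , eq′) with ≡.refl ← restriction-unique r r′ =
        contradiction (≋-trans (≋-sym eq′) eq) Z≇reverse

      orient-length : ∀ σ → length (orient σ) ≡ length Z
      orient-length true  = ≡.refl
      orient-length false = List.length-reverse Z

      orient-All : ∀ {P : Pred Carrier p} σ → All P (orient σ) → All P Z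
      orient-All true  ps = ps
      orient-All {P = P} false ps = ≡.subst (All P) (List.reverse-involutive Z) (all-reverse ps)

      orient-members : ∀ σ → All (_∈ Z) (orient σ)
      orient-members true  = All.tabulateₛ setoid id
      orient-members false = all-reverse (All.tabulateₛ setoid id)

      orient-not : ∀ σ → orient (not σ) ≋ reverse (orient σ)
      orient-not true  = ≋-refl
      orient-not false = ≋-reflexive (≡.sym (List.reverse-involutive Z))

    -- How one arc acts on the walls of another.

    open ArcProperties

    -- Only the walls of `e` inside `Z f` are visible here: at most one if the side is kept, all of
    -- them if it changes. That `Z f` then contains nothing else is left to `flips⇒same-walls`.
    data Effect {a b c d : Vertex w} (e : Arc a b) (f : Arc c d) : Set (g Level.⊔ ℓ) where
      fixes : ∀ {σ xs} → Side e c σ → Side e d σ → Restriction (_∈ Z e) (Z f) xs → length xs ≤ 1 → Effect e f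
      flips : ∀ {σ xs} → Side e c σ → Side e d (not σ) → Restriction (_∈ Z e) (Z f) xs → xs ≋ orient e σ → Effect e f

    -- Restricted to the walls of `e`, the source of `f` gives `us ++ xs ++ vs` and its target gives
    -- the same with `xs` reversed. If both have the same order, cancellation makes `xs` a
    -- palindrome without duplicates, hence short. If the orders are opposite, `reversing-block`
    -- leaves `us` and `vs` empty.
    effect : ∀ {a b c d : Vertex w} (e : Arc a b) (f : Arc c d) → ¬ ¬ Effect e f
    effect {c = c} {d} e f ¬goal =
      restriction-¬¬exists (inv (prefix f)) λ (us , ru) →
      restriction-¬¬exists (Z f) λ (xs , rx) →
      restriction-¬¬exists (tail f) λ (vs , rv) →
      let ys , ≋ys , ry = restriction-≋ (Membership.∈-resp-≈ setoid) (≋-sym (source-inversions f))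
                            (restriction-++⁺ ru (restriction-++⁺ rx rv))
          zs , ≋zs , rz = restriction-≋ (Membership.∈-resp-≈ setoid) (≋-sym (target-inversions f))
                            (restriction-++⁺ ru (restriction-++⁺ (restriction-reverse rx) rv))
          unique = Unique-resp-≋ (≋-sym ≋ys) (restriction-AllPairs ry (vertex-unique c))
          same : ∀ σ → ys ≋ orient e σ → zs ≋ orient e σ → ⊥
          same σ ys≋ zs≋ = ¬goal (fixes {σ = σ} (ys , ry , ys≋) (zs , rz , zs≋) rx
            (unique-palindrome (restriction-AllPairs rx (Z-unique f)) (++-cancelʳ xs (reverse xs)
              (++-cancelˡ us (≋-trans ≋ys (≋-trans ys≋ (≋-sym (≋-trans ≋zs zs≋))))))))
          different : ∀ σ → ys ≋ orient e σ → zs ≋ orient e (not σ) → ⊥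
          different σ ys≋ zs≋ =
            let us≡ , vs≡ = reversing-block us xs vs unique
                  (≡.subst (2 ≤_) (≡.trans (≡.sym (orient-length e σ)) (≡.sym (≋-length (≋-trans ≋ys ys≋)))) (Z-length≥2 e))
                  (≋-trans ≋ys (≋-trans ys≋ (≋-trans
                    (≋-reflexive (≡.sym (List.reverse-involutive (orient e σ))))
                    (reverse⁺ (≋-sym (≋-trans ≋zs (≋-trans zs≋ (orient-not e σ))))))))
            in ¬goal (flips {σ = σ} (ys , ry , ys≋) (zs , rz , zs≋) rx
                 (≋-trans (≋-reflexive (≡.sym (≡.trans (≡.cong₂ (λ us vs → us ++ xs ++ vs) us≡ vs≡) (List.++-identityʳ xs))))
                   (≋-trans ≋ys ys≋)))
      in walls-order e c ry λ where
        (inj₁ ys≋) → walls-order e d rz λ where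
          (inj₁ zs≋) → same true ys≋ zs≋
          (inj₂ zs≋) → different true ys≋ zs≋
        (inj₂ ys≋) → walls-order e d rz λ where
          (inj₁ zs≋) → different false ys≋ zs≋
          (inj₂ zs≋) → same false ys≋ zs≋

    -- Otherwise the restriction would be all of `Z f`, which has at least two entries.
    fixes⇒different-walls : ∀ {a b c d : Vertex w} (e : Arc a b) (f : Arc c d) {xs} σ →
      Restriction (_∈ Z e) (Z f) xs → length xs ≤ 1 → ¬ (Z f ≋ orient e σ)
    fixes⇒different-walls e f σ res short eq
      with ≡.refl ← restriction-total (All-resp-≋ (Membership.∈-resp-≈ setoid) (≋-sym eq) (orient-members e σ)) res
      = contradiction (ℕ.≤-trans (Z-length≥2 f) short) λ { (s≤s ()) }

    -- `Z f` contains every wall of `e` but might be larger. Exchanging the roles excludes this: as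
    -- all of `Z e` lies in `Z f`, the arc `e` must flip the side relative to `f`, so the two blocks
    -- have the same length.
    flips⇒same-walls : ∀ {a b c d : Vertex w} (e : Arc a b) (f : Arc c d) {xs} σ →
      Restriction (_∈ Z e) (Z f) xs → xs ≋ orient e σ → ¬ ¬ (Z f ≋ orient e σ)
    flips⇒same-walls e f {xs} σ res eq ¬goal = effect f e λ where
        (fixes _ _ res′ short) →
          contradiction (ℕ.≤-trans (Z-length≥2 e) (≡.subst (λ l → length l ≤ 1) (restriction-total inside res′) short)) λ { (s≤s ()) }
        (flips {τ} _ _ res′ eq′) → ¬goal (≋-trans (≋-reflexive (≡.sym (restriction-full res (ℕ.≤-reflexive
          (≡.trans (≡.sym (≡.trans (≋-length eq′) (orient-length f τ)))
          (≡.trans (≡.cong length (restriction-total inside res′))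
          (≡.sym (≡.trans (≋-length eq) (orient-length e σ)))))))))
          eq)
      where
      inside : All (_∈ Z f) (Z e)
      inside = orient-All e σ (All-resp-≋ (Membership.∈-resp-≈ setoid) eq
        (restriction-All res (All.tabulateₛ setoid id)))

-- Counts under permutation and pairing of opposite keys.

module _ {P : Pred A p} where

  count-↭ : ∀ {xs ys k} → xs ↭ ys → Count P xs k → Count P ys k
  count-↭ ↭.refl           c                      = c
  count-↭ (↭.prep _ π)     (hit px c)             = hit px (count-↭ π c)
  count-↭ (↭.prep _ π)     (miss ¬px c)           = miss ¬px (count-↭ π c)
  count-↭ (↭.swap _ _ π)   (hit px (hit py c))    = hit py (hit px (count-↭ π c))
  count-↭ (↭.swap _ _ π)   (hit px (miss ¬py c))  = miss ¬py (hit px (count-↭ π c))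
  count-↭ (↭.swap _ _ π)   (miss ¬px (hit py c))  = hit py (miss ¬px (count-↭ π c))
  count-↭ (↭.swap _ _ π)   (miss ¬px (miss ¬py c)) = miss ¬py (miss ¬px (count-↭ π c))
  count-↭ (↭.trans π π′)   c                      = count-↭ π′ (count-↭ π c)

  count-extract : ∀ {xs k} → Count P xs (suc k) → ∃₂ λ x ys → P x × xs ↭ x ∷ ys
  count-extract (hit px c)      = _ , _ , px , ↭.refl
  count-extract {x ∷ xs} (miss _ c) =
    let y , ys , py , π = count-extract c in y , x ∷ ys , py , ↭.trans (↭.prep x π) (↭.swap x y ↭.refl)

  count-pair⁻ : ∀ {x y zs k} → Count P (x ∷ y ∷ zs) k →
                ∃₂ λ i j → ∃[ n ] Count P (x ∷ []) i × Count P (y ∷ []) j × Count P zs n × k ≡ i + (j + n)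
  count-pair⁻ {x} {y} c
    with i , _ , cx , c′ , ≡.refl ← count-++⁻ (x ∷ []) c
    with j , n , cy , cz , ≡.refl ← count-++⁻ (y ∷ []) c′
    = i , j , n , cx , cy , cz , ≡.refl

count-singleton : ∀ {P : Pred A p} {Q : Pred A q} {x y} → (P x → Q y) → (Q y → P x) →
                  ∀ {k l} → Count P (x ∷ []) k → Count Q (y ∷ []) l → k ≡ l
count-singleton {x = x} {y} f g c d =
  count-unique (count-transfer {R = λ x′ y′ → x′ ≡ x × y′ ≡ y} (λ { (≡.refl , ≡.refl) → f }) (λ { (≡.refl , ≡.refl) → g })
    ((≡.refl , ≡.refl) ∷ []) c) d

module Pairing {c} (K : Setoid c ℓ) (opp : Setoid.Carrier K → Setoid.Carrier K)
  (opp-cong : ∀ {x y} → Setoid._≈_ K x y → Setoid._≈_ K (opp x) (opp y))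
  (opp-involutive : ∀ x → Setoid._≈_ K (opp (opp x)) x)
  {A : Set a} (key : A → Setoid.Carrier K) where

  open Setoid K

  -- A perfect matching into opposite keys, kept as data so that it serves every predicate
  -- compatible with `opp`: one colour may comprise many keys.
  data Paired : List A → Set (a Level.⊔ ℓ) where
    []   : Paired []
    pair : ∀ {xs x y ys} → key y ≈ opp (key x) → xs ↭ x ∷ y ∷ ys → Paired ys → Paired xs

  BalancedAt : List A → A → Set _
  BalancedAt xs z = ∀ k l → Count (λ x → key x ≈ key z) xs k → Count (λ x → key x ≈ opp (key z)) xs l → k ≡ l

  private
    flip-opp : ∀ {x y} → x ≈ opp y → opp x ≈ y
    flip-opp eq = trans (opp-cong eq) (opp-involutive _)

    -- What `x` contributes to either count `y` contributes to the other, so the pair adds the same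
    -- amount to both.
    unbalance : ∀ {x y zs} z → key y ≈ opp (key x) → BalancedAt (x ∷ y ∷ zs) z → BalancedAt zs z
    unbalance {x} {y} {zs} z eq bal k l c d = decidable-stable (k ℕ.≟ l) λ k≢l →
      count-¬¬exists {P = λ x → key x ≈ key z} (x ∷ []) λ (i , cx) →
      count-¬¬exists {P = λ x → key x ≈ opp (key z)} (x ∷ []) λ (j , dx) →
      count-¬¬exists {P = λ x → key x ≈ key z} (y ∷ []) λ (i′ , cy) →
      count-¬¬exists {P = λ x → key x ≈ opp (key z)} (y ∷ []) λ (j′ , dy) →
      let i≡j′ = count-singleton (λ e → trans eq (opp-cong e))
                   (λ e → trans (sym (flip-opp eq)) (flip-opp e)) cx dy
          j≡i′ = count-singleton (λ e → trans eq (flip-opp e))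
                   (λ e → trans (sym (flip-opp eq)) (opp-cong e)) dx cy
      in k≢l (ℕ.+-cancelˡ-≡ (i + i′) k l (begin
        i + i′ + k       ≡⟨ ℕ.+-assoc i i′ k ⟩
        i + (i′ + k)     ≡⟨ bal _ _ (count-++⁺ cx (count-++⁺ cy c)) (count-++⁺ dx (count-++⁺ dy d)) ⟩
        j + (j′ + l)     ≡⟨ ℕ.+-assoc j j′ l ⟨
        j + j′ + l       ≡⟨ ≡.cong₂ (λ u v → u + v + l) j≡i′ (≡.sym i≡j′) ⟩
        i′ + i + l       ≡⟨ ≡.cong (_+ l) (ℕ.+-comm i′ i) ⟩
        i + i′ + l       ∎))
      where open ≡.≡-Reasoning

  -- The head `x` counts for its own key and not for the opposite one, so balance at `x` supplies a
  -- partner further on. Removing the two preserves balance. The bound `n` makes the recursion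
  -- terminate, as the remaining list is known only up to permutation.
  balanced⇒paired : ∀ n xs → length xs ≤ n → All (λ x → ¬ key x ≈ opp (key x)) xs →
                    All (BalancedAt xs) xs → ¬ ¬ Paired xs
  balanced⇒paired _       []       _       _ _ ¬paired = ¬paired []
  balanced⇒paired (suc n) (x ∷ xs) (s≤s h) (irr ∷ irrs) (bal ∷ bals) ¬paired =
    count-¬¬exists {P = λ y → key y ≈ key x} xs λ (k , c) →
    count-¬¬exists {P = λ y → key y ≈ opp (key x)} xs λ (l , d) →
    let y , ys , eq , π = count-extract (≡.subst (Count _ xs) (≡.sym (bal _ _ (hit refl c) (miss irr d))) d)
        π′ = ↭.prep x π
        irrs′ = All.tail (All.tail (↭.All-resp-↭ π′ (irr ∷ irrs)))
        bals′ = All.tail (All.tail (↭.All-resp-↭ π′ (bal ∷ bals)))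
    in balanced⇒paired n ys
         (ℕ.≤-trans (ℕ.n≤1+n _) (≡.subst (_≤ n) (↭.↭-length π) h)) irrs′
         (All.map (λ {z} bal → unbalance z eq λ k l c d →
           bal k l (count-↭ (↭.↭-sym π′) c) (count-↭ (↭.↭-sym π′) d)) bals′)
         (¬paired ∘ pair eq π′)

  module _ {P : Pred A p} {Q : Pred A q}
    (P⇒Q : ∀ x y → key y ≈ opp (key x) → P x → Q y) (Q⇒P : ∀ x y → key y ≈ opp (key x) → Q x → P y) where

    private
      key-sym : ∀ {x y} → key y ≈ opp (key x) → key x ≈ opp (key y)
      key-sym eq = sym (flip-opp eq)

    paired-count : ∀ {xs k l} → Paired xs → Count P xs k → Count Q xs l → k ≡ l
    paired-count []              []  [] = ≡.refl
    paired-count (pair {x = x} {y} eq π ps) c d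
      with i , j , k , cx , cy , c′ , ≡.refl ← count-pair⁻ (count-↭ π c)
      with i′ , j′ , l , dx , dy , d′ , ≡.refl ← count-pair⁻ (count-↭ π d)
      with ≡.refl ← count-singleton (P⇒Q x y eq) (Q⇒P y x (key-sym eq)) cx dy
      with ≡.refl ← count-singleton (Q⇒P x y eq) (P⇒Q y x (key-sym eq)) dx cy
      with ≡.refl ← paired-count ps c′ d′
      = begin
        i + (j + k)   ≡⟨ ℕ.+-assoc i j k ⟨
        i + j + k     ≡⟨ ≡.cong (_+ k) (ℕ.+-comm i j) ⟩
        j + i + k     ≡⟨ ℕ.+-assoc j i k ⟩
        j + (i + k)   ∎
      where open ≡.≡-Reasoning

  paired-even : ∀ {P : Pred A p} → (∀ x y → key y ≈ opp (key x) → P x → P y) →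
                ∀ {xs k} → Paired xs → Count P xs k → 2 ∣ k
  paired-even P⇒P []                      []  = divides 0 ≡.refl
  paired-even P⇒P (pair {x = x} {y} eq π ps) c
    with i , j , k , cx , cy , c′ , ≡.refl ← count-pair⁻ (count-↭ π c)
    with ≡.refl ← count-singleton (P⇒P x y eq) (P⇒P y x (sym (flip-opp eq))) cx cy
    = ≡.subst (2 ∣_) (ℕ.+-assoc i i k) (∣m∣n⇒∣m+n (divides i (≡.trans (≡.cong (i +_) (≡.sym (ℕ.+-identityʳ i))) (ℕ.*-comm 2 i)))
        (paired-even P⇒P ps c′))

-- Balance along closed walks and counts of colours.

module Cycles {g ℓ : Level} (X : CoxeterGroup g ℓ) where

  open Arcs X
  open Coxeter X using (𝔐; _ᵒᵖ; _∼_; ∼-isEquivalence; ᵒᵖ-cong; Vertex; Arc; Walk; colours; Colour)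
  open IsEquivalence ∼-isEquivalence using () renaming (sym to ∼-sym; trans to ∼-trans)

  -- The arcs of a walk have different types; an item retains what determines the block and the
  -- colour.
  Item : Set g
  Item = Carrier × 𝔐

  key : Item → List Carrier
  key (q , P) = walls q P

  open Pairing ≋-setoid reverse reverse⁺ (λ xs → ≋-reflexive (List.reverse-involutive xs)) key

  key≋⇒conj₁ : ∀ {q q′ P P′} → walls q P ≋ walls q′ P′ → conj q (gen (𝔐.fst P)) ≈ conj q′ (gen (𝔐.fst P′))
  key≋⇒conj₁ {q} {q′} {P} {P′} eq = go (order≥2 P) (order≥2 P′) eq
    where
    go : ∀ {s t s′ t′ k k′} → 2 ≤ k → 2 ≤ k′ → map (conj q) (ρs s t k) ≋ map (conj q′) (ρs s′ t′ k′) →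
         conj q (gen s) ≈ conj q′ (gen s′)
    go (s≤s _) (s≤s _) (eq ∷ _) = eq

  -- Heads of the two lists compare the conjugates of one pair of generators, heads of the reversed
  -- lists those of the other pair. Both comparisons are undone by the same element q′⁻¹q.
  key≋⇒∼ : ∀ {q q′} P P′ → walls q P ≋ reverse (walls q′ P′) → P ∼ P′ ᵒᵖ
  key≋⇒∼ {q} {q′} P P′ eq = q′ ⁻¹ ∙ q , transport (key≋⇒conj₁ {P = P} {P′ ᵒᵖ} eq₁) , transport (key≋⇒conj₁ {P = P ᵒᵖ} {P′} eq₂)
    where
    eq₁ : walls q P ≋ walls q′ (P′ ᵒᵖ)
    eq₁ = ≋-trans eq (≋-sym (walls-ᵒᵖ q′ P′))
    eq₂ : walls q (P ᵒᵖ) ≋ walls q′ P′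
    eq₂ = ≋-trans (walls-ᵒᵖ q P) (≋-trans (reverse⁺ eq) (≋-reflexive (List.reverse-involutive _)))
    transport : ∀ {x y} → conj q x ≈ conj q′ y → conj (q′ ⁻¹ ∙ q) x ≈ y
    transport eq = trans (conj-∙ (q′ ⁻¹) q _) (trans (conj-congˡ (q′ ⁻¹) eq) (conj-inverse _ (inverseˡ q′)))

  module _ {w : Carrier} where

    open ArcProperties {w}

    item : ∀ {a b : Vertex w} → Arc a b → Item
    item e = base e , Arc.pair e

    items : ∀ {a b : Vertex w} → Walk a b → List Item
    items [ e ]   = item e ∷ []
    items (e ∷ p) = item e ∷ items p

    colours≡ : ∀ {a b : Vertex w} (p : Walk a b) → colours p ≡ map proj₂ (items p)
    colours≡ [ e ]   = ≡.refl
    colours≡ (e ∷ p) = ≡.cong (_ ∷_) (colours≡ p)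

    items-All : ∀ {Q : Pred Item p} → (∀ {a b : Vertex w} (e : Arc a b) → Q (item e)) →
                ∀ {a b : Vertex w} (p : Walk a b) → All Q (items p)
    items-All q [ e ]   = q e ∷ []
    items-All q (e ∷ p) = q e ∷ items-All q p

    value : Bool → ℕ
    value true  = 1
    value false = 0

    module _ {a b : Vertex w} (e : Arc a b) where

      Forward Backward : Pred Item _
      Forward  i = key i ≋ Z e
      Backward i = key i ≋ reverse (Z e)

      -- The side relative to `e` acts as a potential: an arc with block `Z e` lowers `value` from 1
      -- to 0, one with the reversed block raises it from 0 to 1, and any other arc preserves it.
      -- The additive form avoids subtraction in ℕ.
      arc-balance : ∀ {c d : Vertex w} (f : Arc c d) {k l σ τ} →
                    Count Forward (item f ∷ []) k → Count Backward (item f ∷ []) l →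
                    Side e c σ → Side e d τ → k + value τ ≡ l + value σ
      arc-balance {c} {d} f {k} {l} {σ} {τ} x y s t =
        decidable-stable (k + value τ ℕ.≟ l + value σ) λ ≢ → effect e f (compare ≢)
        where
        flipped : ∀ σ′ → Z f ≋ orient e σ′ → σ ≡ σ′ → τ ≡ not σ′ → k + value τ ≡ l + value σ
        flipped true eq ≡.refl ≡.refl
          with ≡.refl ← count-unique x (hit eq [])
          with ≡.refl ← count-unique y (miss (λ eq′ → Z≇reverse e (≋-trans (≋-sym eq) eq′)) []) = ≡.refl
        flipped false eq ≡.refl ≡.refl
          with ≡.refl ← count-unique x (miss (λ eq′ → Z≇reverse e (≋-trans (≋-sym eq′) eq)) [])
          with ≡.refl ← count-unique y (hit eq []) = ≡.refl
        compare : ¬ (k + value τ ≡ l + value σ) → ¬ Effect e f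
        compare ≢ (fixes {σ′} s′ t′ res short) = ≢ (≡.cong₂ _+_
          (≡.trans (count-unique x (count-none (fixes⇒different-walls e f true res short ∷ [])))
            (≡.sym (count-unique y (count-none (fixes⇒different-walls e f false res short ∷ [])))))
          (≡.cong value (≡.trans (side-unique e d {τ} {σ′} t t′) (side-unique e c {σ′} {σ} s′ s))))
        compare ≢ (flips {σ′} s′ t′ res eq) = flips⇒same-walls e f σ′ res eq λ same →
          ≢ (flipped σ′ same (side-unique e c {σ} {σ′} s s′) (side-unique e d {τ} {not σ′} t t′))

      -- The changes of the potential telescope over the intermediate vertices.
      walk-balance : ∀ {c d : Vertex w} (p : Walk c d) {k l σ τ} →
                     Count Forward (items p) k → Count Backward (items p) l →
                     Side e c σ → Side e d τ → k + value τ ≡ l + value σ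
      walk-balance [ f ] x y s t = arc-balance f x y s t
      walk-balance (_∷_ {y = c′} f p) {k} {l} {σ} {τ} x y s t
        with k₁ , k₂ , x₁ , x₂ , ≡.refl ← count-++⁻ (item f ∷ []) x
        with l₁ , l₂ , y₁ , y₂ , ≡.refl ← count-++⁻ (item f ∷ []) y
        = decidable-stable (k₁ + k₂ + value τ ℕ.≟ l₁ + l₂ + value σ) λ ≢ →
          side-exists e c′ λ (υ , u) → ≢ (begin
            k₁ + k₂ + value τ       ≡⟨ ℕ.+-assoc k₁ k₂ _ ⟩
            k₁ + (k₂ + value τ)     ≡⟨ ≡.cong (k₁ +_) (walk-balance p {σ = υ} {τ} x₂ y₂ u t) ⟩
            k₁ + (l₂ + value υ)     ≡⟨ ℕ.+-assoc k₁ l₂ _ ⟨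
            k₁ + l₂ + value υ       ≡⟨ ≡.cong (_+ value υ) (ℕ.+-comm k₁ l₂) ⟩
            l₂ + k₁ + value υ       ≡⟨ ℕ.+-assoc l₂ k₁ _ ⟩
            l₂ + (k₁ + value υ)     ≡⟨ ≡.cong (l₂ +_) (arc-balance f {σ = σ} {υ} x₁ y₁ s u) ⟩
            l₂ + (l₁ + value σ)     ≡⟨ ℕ.+-assoc l₂ l₁ _ ⟨
            l₂ + l₁ + value σ       ≡⟨ ≡.cong (_+ value σ) (ℕ.+-comm l₂ l₁) ⟩
            l₁ + l₂ + value σ       ∎)
        where open ≡.≡-Reasoning

      closed-walk-balanced : ∀ {c : Vertex w} (p : Walk c c) → BalancedAt (items p) (item e)
      closed-walk-balanced {c} p k l x y = decidable-stable (k ℕ.≟ l) λ k≢l →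
        side-exists e c λ (σ , s) → k≢l (ℕ.+-cancelʳ-≡ (value σ) k l (walk-balance p {σ = σ} {σ} x y s s))

    closed-walk-paired : ∀ {c : Vertex w} (p : Walk c c) → ¬ ¬ Paired (items p)
    closed-walk-paired p = balanced⇒paired _ (items p) ℕ.≤-refl
      (items-All Z≇reverse p) (items-All (λ e → closed-walk-balanced e p) p)

    module _ {c : Vertex w} (p : Walk c c) (C : Colour) where

      count-colours⁻ : ∀ {r k} {P : Pred Colour r} → Count P (colours p) k → Count (P ∘ proj₂) (items p) k
      count-colours⁻ {P = P} x = count-map⁻ (items p) (≡.subst (λ cs → Count P cs _) (colours≡ p) x)

      toᵒᵖ : ∀ (x y : Item) → key y ≋ reverse (key x) → proj₂ x ∼ C → proj₂ y ∼ C ᵒᵖ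
      toᵒᵖ x y eq x∼ = ∼-trans {proj₂ y} {proj₂ x ᵒᵖ} {C ᵒᵖ} (key≋⇒∼ (proj₂ y) (proj₂ x) eq) (ᵒᵖ-cong {proj₂ x} {C} x∼)

      fromᵒᵖ : ∀ (x y : Item) → key y ≋ reverse (key x) → proj₂ x ∼ C ᵒᵖ → proj₂ y ∼ C
      fromᵒᵖ x y eq x∼ = ∼-trans {proj₂ y} {proj₂ x ᵒᵖ} {C} (key≋⇒∼ (proj₂ y) (proj₂ x) eq) (ᵒᵖ-cong {proj₂ x} {C ᵒᵖ} x∼)

      colour-count : ∀ k l → Count (_∼ C) (colours p) k → Count (_∼ C ᵒᵖ) (colours p) l → k ≡ l
      colour-count k l x y = decidable-stable (k ℕ.≟ l) λ k≢l → closed-walk-paired p λ paired →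
        k≢l (paired-count {P = λ i → proj₂ i ∼ C} {Q = λ i → proj₂ i ∼ C ᵒᵖ} toᵒᵖ fromᵒᵖ paired
          (count-colours⁻ x) (count-colours⁻ y))

      colour-even : ∀ k → Count (λ d → (d ∼ C) ⊎ (d ∼ C ᵒᵖ)) (colours p) k → 2 ∣ k
      colour-even k x = decidable-stable (2 ∣? k) λ 2∤k → closed-walk-paired p λ paired →
        2∤k (paired-even {P = λ i → (proj₂ i ∼ C) ⊎ (proj₂ i ∼ C ᵒᵖ)}
          (λ x y eq → Sum.swap ∘ Sum.map (toᵒᵖ x y eq) (fromᵒᵖ x y eq)) paired (count-colours⁻ x))

theorem2p3 : ∀ {g ℓ : Level} (X : CoxeterGroup g ℓ) → let open Coxeter X in
    (w : CoxeterGroup.Carrier X) (C : DirectedCycle w) (c : Colour) →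
    (∀ (k l : ℕ) → NumberOfArcs C (λ d → d ∼ c) k → NumberOfArcs C (λ d → d ∼ c ᵒᵖ) l → k ≡ l)
    × (∀ (k : ℕ) → NumberOfArcs C (λ d → (d ∼ c) ⊎ (d ∼ c ᵒᵖ)) k → 2 ∣ k)
theorem2p3 X w C c = Cycles.colour-count X walk c , Cycles.colour-even X walk c
  where open Coxeter.DirectedCycle C
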